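{- Restricted to instances $(G,A,b,c)$ with $c=0$, the problem Effectors can be solved in linear time.
   Context: An influence graph $G=(V,E,w)$ is a finite simple directed graph (no loops) with a weight function $w:E\to(0,1]\cap\mathbb{Q}$; $n=|V|$, $m=|E|$, and linear time means $O(n+m)$. Independent Cascade process started from $X\subseteq V$: at time $0$ exactly the nodes in $X$ are active. When a node $u$ becomes active for the first time, at time step $t$, it gets a single chance to activate each currently inactive out-neighbor $v$, succeeding with probability $w(u\to v)$, all attempts being independent; if it succeeds, $v$ becomes active at step $t+1$; if it fails, $u$ makes no further attempts on $v$. Active nodes stay active. The process terminates when there are no newly activated nodes. Let $p(v|X)$ be the probability that $v$ is active upon termination. Cost: for $A\subseteq V$ and $X\subseteq V$, $C_A(G,X):=\sum_{v\in A}(1-p(v|X))+\sum_{v\in V\setminus A}p(v|X)$. Effectors: given an influence graph $G=(V,E,w)$, a set of target nodes $A\subseteq V$, a budget $b\in\mathbb{N}$ and a cost $c\in\mathbb{Q}$, decide whether there is a set $X\subseteq V$ (of effectors) with $|X|\le b$ and $C_A(G,X)\le c$. Running-time convention: operations on the rational numbers in the input take constant time. -}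

module Defs where

open import Data.Bool.Base using (Bool; true; false; if_then_else_; _∧_; not)
open import Data.Fin.Base using (Fin; toℕ)
open import Data.Fin.Subset using (Subset; ⊥; ⁅_⁆; _∪_; ∁; ∣_∣)
open import Data.Fin.Subset.Properties using (_∈?_)
open import Data.List.Base using (List; []; _∷_; _++_; map; filter; foldr; allFin; tabulate)
open import Data.Nat.Base using (ℕ; zero; suc; _+_; _*_; _∸_; _≤_; _≤ᵇ_; _≡ᵇ_)
open import Data.Product.Base using (∃-syntax; _×_)
open import Data.Rational.Base as ℚ using (ℚ; 0ℚ; 1ℚ)
open import Function.Bundles using (_⇔_)
open import Relation.Binary.PropositionalEquality.Core using (_≡_; _≢_)
open import Relation.Nullary.Decidable.Core using (does)

-- A finite random experiment as a tree of mutually independent coin tosses: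
-- `flip q d e` continues as d with probability q and as e otherwise.
data Dist (A : Set) : Set where
  return : A → Dist A
  flip   : ℚ → Dist A → Dist A → Dist A

infixl 1 _>>=_

_>>=_ : {A B : Set} → Dist A → (A → Dist B) → Dist B
return a   >>= k = k a
flip q d e >>= k = flip q (d >>= k) (e >>= k)

Pr : {A : Set} → (A → Bool) → Dist A → ℚ
Pr P (return a)   = if P a then 1ℚ else 0ℚ
Pr P (flip q d e) = q ℚ.* Pr P d ℚ.+ (1ℚ ℚ.- q) ℚ.* Pr P e

-- Nodes are Fin n.  The edge set is enumerated, without repetition and in
-- arbitrary order, by Fin m.
record InfluenceGraph (n m : ℕ) : Set where
  field
    src tgt  : Fin m → Fin n
    weight   : Fin m → ℚ
    loopless : ∀ e → src e ≢ tgt e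
    simple   : ∀ e f → src e ≡ src f → tgt e ≡ tgt f → e ≡ f
    weight>0 : ∀ e → 0ℚ ℚ.< weight e
    weight≤1 : ∀ e → weight e ℚ.≤ 1ℚ

module _ {n m : ℕ} (G : InfluenceGraph n m) where
  open InfluenceGraph G

  -- The random set of nodes activated by `new`, the nodes that became active
  -- in the previous step, where `active` is the set of all active nodes
  -- (including `new`).  Only the edges in the given list are considered.
  attempts : (active new : Subset n) → List (Fin m) → Dist (Subset n)
  attempts active new []       = return ⊥
  attempts active new (e ∷ es) =
    attempts active new es >>= λ hit →
    if does (src e ∈? new) ∧ not (does (tgt e ∈? active))
      then flip (weight e) (return (⁅ tgt e ⁆ ∪ hit)) (return hit)
      else return hit

  cascade : ℕ → (active new : Subset n) → Dist (Subset n)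
  cascade zero    active new = return active
  cascade (suc t) active new =
    attempts active new (allFin m) >>= λ hit → cascade t (active ∪ hit) hit

  -- p(v | X).  As long as the process has not terminated, every step activates
  -- at least one further node, so it has terminated by time n; once there are
  -- no new nodes, further steps change nothing.
  p : Fin n → Subset n → ℚ
  p v X = Pr (λ active → does (v ∈? active)) (cascade n X X)

  sumOver : Subset n → (Fin n → ℚ) → ℚ
  sumOver S f = foldr ℚ._+_ 0ℚ (map f (filter (_∈? S) (allFin n)))

  C : (A X : Subset n) → ℚ
  C A X = sumOver A (λ v → 1ℚ ℚ.- p v X) ℚ.+ sumOver (∁ A) (λ v → p v X)

record Instance : Set where
  field
    {n m} : ℕ
    G     : InfluenceGraph n m
    A     : Subset n
    b     : ℕ
    c     : ℚ

Effectors : Instance → Set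
Effectors I = ∃[ X ] ∣ X ∣ ≤ b × C G A X ℚ.≤ c
  where open Instance I

-- A uniform-cost RAM with structured control flow.  It has registers and an
-- indirectly addressable memory for natural numbers, and likewise for
-- rationals; both memories are addressed by natural-number registers.  To keep
-- unit cost reasonable for unbounded numbers, naturals can only be added and
-- subtracted, and rationals influence naturals only through comparisons.

Reg QReg : Set
Reg  = ℕ
QReg = ℕ

data Instr : Set where
  const           : Reg → ℕ → Instr
  add sub         : (dst x y : Reg) → Instr
  load            : (dst addr : Reg) → Instr
  store           : (addr x : Reg) → Instr
  qconst          : QReg → ℚ → Instr
  qadd qsub qmul  : (dst x y : QReg) → Instr
  qload           : (dst : QReg) (addr : Reg) → Instr
  qstore          : (addr : Reg) (x : QReg) → Instr

data Test : Set where
  leq  : (x y : Reg) → Test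
  qleq : (x y : QReg) → Test

infixr 5 _⨾_

data Program : Set where
  skip       : Program
  instr      : Instr → Program
  _⨾_        : Program → Program → Program
  ifte       : Test → Program → Program → Program
  while      : Test → Program → Program

record State : Set where
  constructor mkState
  field
    reg  : Reg → ℕ
    mem  : ℕ → ℕ
    qreg : QReg → ℚ
    qmem : ℕ → ℚ

_[_≔_] : {A : Set} → (ℕ → A) → ℕ → A → (ℕ → A)
(f [ i ≔ x ]) j = if j ≡ᵇ i then x else f j

exec : Instr → State → State
exec ins σ = go ins
  where
  open State σ
  go : Instr → State
  go (const d k)  = record σ { reg  = reg  [ d ≔ k ] }
  go (add d x y)  = record σ { reg  = reg  [ d ≔ reg x + reg y ] }
  go (sub d x y)  = record σ { reg  = reg  [ d ≔ reg x ∸ reg y ] }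
  go (load d a)   = record σ { reg  = reg  [ d ≔ mem (reg a) ] }
  go (store a x)  = record σ { mem  = mem  [ reg a ≔ reg x ] }
  go (qconst d k) = record σ { qreg = qreg [ d ≔ k ] }
  go (qadd d x y) = record σ { qreg = qreg [ d ≔ qreg x ℚ.+ qreg y ] }
  go (qsub d x y) = record σ { qreg = qreg [ d ≔ qreg x ℚ.- qreg y ] }
  go (qmul d x y) = record σ { qreg = qreg [ d ≔ qreg x ℚ.* qreg y ] }
  go (qload d a)  = record σ { qreg = qreg [ d ≔ qmem (reg a) ] }
  go (qstore a x) = record σ { qmem = qmem [ reg a ≔ qreg x ] }

eval : Test → State → Bool
eval (leq x y)  σ = State.reg σ x ≤ᵇ State.reg σ y
eval (qleq x y) σ = State.qreg σ x ℚ.≤ᵇ State.qreg σ y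

-- ⟨ P , σ ⟩⇓[ t ] τ: started in σ, the program P halts in τ after t steps, where
-- every executed instruction and every evaluated test is one step.
data ⟨_,_⟩⇓[_]_ : Program → State → ℕ → State → Set where
  skip⇓    : ∀ {σ} → ⟨ skip , σ ⟩⇓[ 0 ] σ
  instr⇓   : ∀ {i σ} → ⟨ instr i , σ ⟩⇓[ 1 ] exec i σ
  seq⇓     : ∀ {P Q σ τ υ s t} →
             ⟨ P , σ ⟩⇓[ s ] τ → ⟨ Q , τ ⟩⇓[ t ] υ → ⟨ P ⨾ Q , σ ⟩⇓[ s + t ] υ
  if-yes⇓  : ∀ {B P Q σ τ t} → eval B σ ≡ true →
             ⟨ P , σ ⟩⇓[ t ] τ → ⟨ ifte B P Q , σ ⟩⇓[ suc t ] τ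
  if-no⇓   : ∀ {B P Q σ τ t} → eval B σ ≡ false →
             ⟨ Q , σ ⟩⇓[ t ] τ → ⟨ ifte B P Q , σ ⟩⇓[ suc t ] τ
  loop⇓    : ∀ {B P σ τ υ s t} → eval B σ ≡ true →
             ⟨ P , σ ⟩⇓[ s ] τ → ⟨ while B P , τ ⟩⇓[ t ] υ →
             ⟨ while B P , σ ⟩⇓[ suc (s + t) ] υ
  exit⇓    : ∀ {B P σ} → eval B σ ≡ false → ⟨ while B P , σ ⟩⇓[ 1 ] σ

contents : {A : Set} → A → List A → ℕ → A
contents d []       _       = d
contents d (x ∷ xs) zero    = x
contents d (x ∷ xs) (suc i) = contents d xs i

-- The natural-number memory holds n, m, b, the characteristic vector of A, the
-- sources of all edges and the targets of all edges; the rational memory holds c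
-- and the weights of all edges.  All other cells and registers are zero.
input : Instance → State
input I = mkState (λ _ → 0) (contents 0 naturals) (λ _ → 0ℚ) (contents 0ℚ rationals)
  where
  open Instance I
  open InfluenceGraph G
  naturals : List ℕ
  naturals = n ∷ m ∷ b ∷
    tabulate (λ v → if does (v ∈? A) then 1 else 0) ++
    tabulate (λ e → toℕ (src e)) ++
    tabulate (λ e → toℕ (tgt e))
  rationals : List ℚ
  rationals = c ∷ tabulate weight

Accepting : State → Set
Accepting σ = State.reg σ 0 ≡ 1

-- The time bound is k (1 + n + m) rather than k (n + m) since even on the empty
-- graph the machine has to inspect b and c or produce an answer.
SolvableInLinearTime : (restriction problem : Instance → Set) → Set
SolvableInLinearTime restriction problem =
  ∃[ P ] ∃[ k ] ∀ (I : Instance) → restriction I →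
  ∃[ t ] ∃[ τ ] ⟨ P , input I ⟩⇓[ t ] τ
              × t ≤ k * (1 + Instance.n I + Instance.m I)
              × (Accepting τ ⇔ problem I)

{-# OPTIONS --safe #-}
module Submission where

-- With positive probability all attempts succeed, and with positive probability
-- all attempts along edges of weight below 1 fail, while attempts along edges of
-- weight 1 never do.  Hence X has cost 0 exactly if X ⊆ A, no edge leaves A, and
-- every node of A is reachable from X along edges of weight 1.
--
-- The least such X is found by two rounds of graph search along the edges of
-- weight 1.  A round takes candidates one after the other and, whenever one has
-- not been visited, selects it and visits everything reachable from it; so no
-- selected node is reachable from one selected earlier.  The first round takes
-- the nodes of A as candidates, the second one the nodes selected in the first
-- round, in reverse order.  The final selection reaches all of A, and its members
-- do not reach each other in either order.  If X reaches all of A, then mapping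
-- each selected r to a node of X that reaches r is injective, because that node
-- is itself reached by a selected node, which can only be r.

open import Defs
open import Data.Bool.Base using (Bool; true; false; if_then_else_; T; _∧_; not)
open import Data.Bool.Properties using (T-≡)
open import Data.Empty as Empty using (⊥-elim)
open import Data.Fin.Base as Fin using (Fin; toℕ; fromℕ<)
import Data.Fin.Properties as Fin
open import Data.Fin.Subset as Subset using (Subset; _∈_; _∉_; _⊆_; ∣_∣; _∪_; ⁅_⁆; ∁; _-_; inside; outside; Empty; Nonempty)
open import Data.Fin.Subset.Properties
  using (_∈?_; nonempty?; x∈p∪q⁻; x∈p∪q⁺; p⊆p∪q; x∈⁅x⁆; x∈⁅y⁆⇒x≡y; ∣p∣≡n⇒p≡⊤; ∣p∣≤n; ∈⊤; p⊂q⇒∣p∣<∣q∣; ∉⊥;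
    x∈∁p⇒x∉p; x∉p⇒x∈∁p; ∣⊥∣≡0; ∣⁅x⁆∣≡1; x∈p⇒∣p-x∣<∣p∣; x∈p∧x≢y⇒x∈p-y; p─q⊆p)
open import Data.List.Base as List using (List; []; _∷_; _++_; foldr; map; filter; allFin; length)
open import Data.List.Membership.Propositional as L using ()
open import Data.List.Membership.Propositional.Properties using (∈-allFin; ∈-filter⁺; ∈-filter⁻)
open import Data.List.Relation.Unary.All as All using (All; []; _∷_)
open import Data.List.Relation.Unary.AllPairs as AllPairs using (AllPairs; []; _∷_)
open import Data.List.Relation.Unary.Any using (here; there)
open import Data.Nat.Base as ℕ using (ℕ; zero; suc; _+_; _*_; _∸_; _≤_; _<_; z≤n; s≤s; _<ᵇ_; _≡ᵇ_)
open import Data.Nat.Induction using (<-wellFounded; Acc; acc)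
import Data.Nat.Properties as ℕ
import Data.Nat.Solver as ℕ-Solver
open import Data.Product.Base using (∃-syntax; _×_; _,_; proj₁; proj₂)
open import Data.Rational.Base as ℚ using (ℚ; 0ℚ; 1ℚ)
import Data.Rational.Properties as ℚ
open import Data.Rational.Solver using (module +-*-Solver)
open import Data.Sum.Base as Sum using (_⊎_; inj₁; inj₂; [_,_]′)
open import Data.Unit.Base using (⊤; tt)
open import Data.Vec.Base as Vec using ([]; _∷_)
open import Data.Vec.Properties using (lookup∘tabulate; lookup⇒[]=; []=⇒lookup)
open import Function.Base using (_∘_)
open import Function.Bundles using (_⇔_; mk⇔; Equivalence)
open import Relation.Binary.Construct.Closure.ReflexiveTransitive using (Star; ε; _◅_; _◅◅_)
open import Relation.Binary.Definitions using (tri<; tri≈; tri>)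
open import Relation.Binary.PropositionalEquality
open import Relation.Nullary using (¬_; Dec; yes; no; does; contradiction)
open import Relation.Nullary.Decidable using (dec-true; dec-false)

-- Cost zero in terms of reachability

-- Probabilities are never computed. Cost 0 forces every `p v X` to be 0 or 1, and whether it is
-- depends only on which outcomes have positive probability, so the cascade is studied through
-- predicates on chosen branches of the tree of coin tosses. When no edge leaves A, an optimal X has
-- one node in each source component of the strong components that the edges of weight 1 induce on
-- A. Two rounds find such nodes without computing components. The second round selects among these
-- nodes only, so the one-sided property of the first persists, and the reversed order supplies the
-- other side. The linear bound does not sum out-degrees over nested loops: each search is one loop
-- with a loop-free body, paid for by a potential.

mix : ℚ → ℚ → ℚ → ℚ
mix q x y = q ℚ.* x ℚ.+ (1ℚ ℚ.- q) ℚ.* y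

InUnit : ℚ → Set
InUnit x = 0ℚ ℚ.≤ x × x ℚ.≤ 1ℚ

Bias : ℚ → Set
Bias q = 0ℚ ℚ.< q × q ℚ.≤ 1ℚ

0≤1 : 0ℚ ℚ.≤ 1ℚ
0≤1 = ℚ.nonNegative⁻¹ 1ℚ

x≤y⇒0≤y-x : ∀ {x y} → x ℚ.≤ y → 0ℚ ℚ.≤ y ℚ.- x
x≤y⇒0≤y-x {x} {y} x≤y = subst (ℚ._≤ y ℚ.- x) (ℚ.+-inverseʳ x) (ℚ.+-monoˡ-≤ (ℚ.- x) x≤y)

x<y⇒0<y-x : ∀ {x y} → x ℚ.< y → 0ℚ ℚ.< y ℚ.- x
x<y⇒0<y-x {x} {y} x<y = subst (ℚ._< y ℚ.- x) (ℚ.+-inverseʳ x) (ℚ.+-monoˡ-< (ℚ.- x) x<y)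

*-monoˡ-≤ : ∀ {r x y} → 0ℚ ℚ.≤ r → x ℚ.≤ y → r ℚ.* x ℚ.≤ r ℚ.* y
*-monoˡ-≤ {r} 0≤r = ℚ.*-monoˡ-≤-nonNeg r {{ℚ.nonNegative 0≤r}}

*-cancelˡ-≤ : ∀ {r x y} → 0ℚ ℚ.< r → r ℚ.* x ℚ.≤ r ℚ.* y → x ℚ.≤ y
*-cancelˡ-≤ {r} 0<r = ℚ.*-cancelˡ-≤-pos r {{ℚ.positive 0<r}}

mix-same : ∀ q x → mix q x x ≡ x
mix-same = solve 2 (λ q x → q :* x :+ (con 1ℚ :- q) :* x := x) refl
  where open +-*-Solver

mix-1 : ∀ x y → mix 1ℚ x y ≡ x
mix-1 = solve 2 (λ x y → con 1ℚ :* x :+ (con 1ℚ :- con 1ℚ) :* y := x) refl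
  where open +-*-Solver

mix-mono : ∀ {q x y x′ y′} → Bias q → x ℚ.≤ x′ → y ℚ.≤ y′ → mix q x y ℚ.≤ mix q x′ y′
mix-mono (0<q , q≤1) x≤x′ y≤y′ =
  ℚ.+-mono-≤ (*-monoˡ-≤ (ℚ.<⇒≤ 0<q) x≤x′) (*-monoˡ-≤ (x≤y⇒0≤y-x q≤1) y≤y′)

mix-inUnit : ∀ {q x y} → Bias q → InUnit x → InUnit y → InUnit (mix q x y)
mix-inUnit {q} {x} {y} β (0≤x , x≤1) (0≤y , y≤1) =
  subst (ℚ._≤ mix q x y) (mix-same q 0ℚ) (mix-mono β 0≤x 0≤y) ,
  subst (mix q x y ℚ.≤_) (mix-same q 1ℚ) (mix-mono β x≤1 y≤1)

mix≡0⇒x≡0 : ∀ {q x y} → Bias q → InUnit x → InUnit y → mix q x y ≡ 0ℚ → x ≡ 0ℚ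
mix≡0⇒x≡0 {q} {x} {y} β@(0<q , _) (0≤x , _) (0≤y , _) eq =
  ℚ.≤-antisym (*-cancelˡ-≤ 0<q qx≤q0) 0≤x
  where
  mix-0ʳ : ∀ q x → mix q x 0ℚ ≡ q ℚ.* x
  mix-0ʳ = solve 2 (λ q x → q :* x :+ (con 1ℚ :- q) :* con 0ℚ := q :* x) refl
    where open +-*-Solver
  qx≤q0 : q ℚ.* x ℚ.≤ q ℚ.* 0ℚ
  qx≤q0 = subst₂ ℚ._≤_ (mix-0ʳ q x) (trans eq (sym (ℚ.*-zeroʳ q))) (mix-mono β (ℚ.≤-refl {x}) 0≤y)

mix≡1⇒y≡1 : ∀ {q x y} → Bias q → q ≢ 1ℚ → InUnit x → InUnit y → mix q x y ≡ 1ℚ → y ≡ 1ℚ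
mix≡1⇒y≡1 {q} {x} {y} β@(_ , q≤1) q≢1 (_ , x≤1) (_ , y≤1) eq =
  ℚ.≤-antisym y≤1 (*-cancelˡ-≤ (x<y⇒0<y-x q<1) 1-q≤)
  where
  q<1 : q ℚ.< 1ℚ
  q<1 = ℚ.≰⇒> λ 1≤q → q≢1 (ℚ.≤-antisym q≤1 1≤q)
  cancel-q : ∀ q y → (ℚ.- q) ℚ.+ mix q 1ℚ y ≡ (1ℚ ℚ.- q) ℚ.* y
  cancel-q = solve 2 (λ q y → (:- q) :+ (q :* con 1ℚ :+ (con 1ℚ :- q) :* y) := (con 1ℚ :- q) :* y) refl
    where open +-*-Solver
  comm : ∀ q → (ℚ.- q) ℚ.+ 1ℚ ≡ (1ℚ ℚ.- q) ℚ.* 1ℚ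
  comm = solve 1 (λ q → (:- q) :+ con 1ℚ := (con 1ℚ :- q) :* con 1ℚ) refl
    where open +-*-Solver
  1-q≤ : (1ℚ ℚ.- q) ℚ.* 1ℚ ℚ.≤ (1ℚ ℚ.- q) ℚ.* y
  1-q≤ = subst₂ ℚ._≤_ (comm q) (cancel-q q y)
    (ℚ.+-monoʳ-≤ (ℚ.- q) (subst (ℚ._≤ mix q 1ℚ y) eq (mix-mono β x≤1 (ℚ.≤-refl {y}))))

-- Events of probability zero and one

Biased : {A : Set} → Dist A → Set
Biased (return _)   = ⊤
Biased (flip q d e) = Bias q × Biased d × Biased e

Biased-bind : {A B : Set} (d : Dist A) {k : A → Dist B} →
              Biased d → (∀ a → Biased (k a)) → Biased (d >>= k)
Biased-bind (return a)   _            bk = bk a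
Biased-bind (flip q d e) (β , bd , be) bk = β , Biased-bind d bd bk , Biased-bind e be bk

Pr-inUnit : {A : Set} (P : A → Bool) (d : Dist A) → Biased d → InUnit (Pr P d)
Pr-inUnit P (return a) _ with P a
... | true  = 0≤1 , ℚ.≤-refl
... | false = ℚ.≤-refl , 0≤1
Pr-inUnit P (flip q d e) (β , bd , be) = mix-inUnit β (Pr-inUnit P d bd) (Pr-inUnit P e be)

-- L and R say which branches of a coin toss of given bias are taken into account.
Always : (L R : ℚ → Set) {A : Set} → (A → Set) → Dist A → Set
Always L R Q (return a)   = Q a
Always L R Q (flip q d e) = (L q → Always L R Q d) × (R q → Always L R Q e)

module _ {L R : ℚ → Set} where
  Always-bind : {A B : Set} {P : A → Set} {Q : B → Set} (d : Dist A) {k : A → Dist B} →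
                Always L R P d → (∀ a → P a → Always L R Q (k a)) → Always L R Q (d >>= k)
  Always-bind (return a)   pa        f = f a pa
  Always-bind (flip q d e) (ad , ae) f =
    (λ l → Always-bind d (ad l) f) , (λ r → Always-bind e (ae r) f)

  Always-map : {A : Set} {P Q : A → Set} (d : Dist A) → (∀ a → P a → Q a) →
               Always L R P d → Always L R Q d
  Always-map (return a)   f pa        = f a pa
  Always-map (flip q d e) f (ad , ae) = Always-map d f ∘ ad , Always-map e f ∘ ae

-- Three pairs serve as `L` and `R`. For biases in (0,1], `Any` and `Uncertain` keep exactly the
-- outcomes of positive probability, `Certain` and `Uncertain` the single outcome in which only
-- tosses of bias 1 succeed, and `Any` and `Never` the one in which all tosses succeed.
Any Certain Uncertain Never : ℚ → Set
Any _       = ⊤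
Certain q   = q ≡ 1ℚ
Uncertain q = q ≢ 1ℚ
Never _     = Empty.⊥

-- At bias 1 the failure branch has weight 0. At any other bias both branches have the same
-- probability, and so has their mixture.
Pr-always : {A : Set} (P : A → Bool) (β : Bool) (d : Dist A) →
            Always Any Uncertain (λ a → P a ≡ β) d → Pr P d ≡ (if β then 1ℚ else 0ℚ)
Pr-always P β (return a) eq = cong (if_then 1ℚ else 0ℚ) eq
Pr-always P β (flip q d e) (ad , ae) with q ℚ.≟ 1ℚ
... | yes refl = trans (mix-1 (Pr P d) (Pr P e)) (Pr-always P β d (ad tt))
... | no q≢1   = trans (cong₂ (mix q) (Pr-always P β d (ad tt)) (Pr-always P β e (ae q≢1))) (mix-same q _)

-- An outcome of positive probability in which every uncertain toss fails.
Pr≡1⇒witness : {A : Set} {P : A → Bool} {Q : A → Set} (d : Dist A) → Biased d →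
               Always Certain Uncertain Q d → Pr P d ≡ 1ℚ → ∃[ a ] Q a × P a ≡ true
Pr≡1⇒witness {P = P} (return a) _ qa eq with P a in pa
... | true  = a , qa , pa
... | false = contradiction eq λ ()
Pr≡1⇒witness {P = P} (flip q d e) (β , bd , be) (ad , ae) eq with q ℚ.≟ 1ℚ
... | yes refl = Pr≡1⇒witness d bd (ad refl) (trans (sym (mix-1 (Pr P d) (Pr P e))) eq)
... | no q≢1   = Pr≡1⇒witness e be (ae q≢1)
                   (mix≡1⇒y≡1 β q≢1 (Pr-inUnit P d bd) (Pr-inUnit P e be) eq)

-- An outcome of positive probability in which every toss succeeds.
Pr≡0⇒witness : {A : Set} {P : A → Bool} {Q : A → Set} (d : Dist A) → Biased d →
               Always Any Never Q d → Pr P d ≡ 0ℚ → ∃[ a ] Q a × P a ≡ false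
Pr≡0⇒witness {P = P} (return a) _ qa eq with P a in pa
... | true  = contradiction eq λ ()
... | false = a , qa , pa
Pr≡0⇒witness {P = P} (flip q d e) (β , bd , be) (ad , _) eq =
  Pr≡0⇒witness d bd (ad tt) (mix≡0⇒x≡0 β (Pr-inUnit P d bd) (Pr-inUnit P e be) eq)

does-true⇒∈ : ∀ {n} {v : Fin n} (S : Subset n) → does (v ∈? S) ≡ true → v ∈ S
does-true⇒∈ {v = v} S eq with v ∈? S
... | yes v∈S = v∈S

does-false⇒∉ : ∀ {n} {v : Fin n} (S : Subset n) → does (v ∈? S) ≡ false → v ∉ S
does-false⇒∉ {v = v} S eq with v ∈? S
... | no v∉S = v∉S

-- Outcomes of the cascade and cost zero

module _ {n m : ℕ} (G : InfluenceGraph n m) where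
  open InfluenceGraph G

  Step : (ℚ → Set) → Fin n → Fin n → Set
  Step L u v = ∃[ e ] L (weight e) × src e ≡ u × tgt e ≡ v

  attempts-biased : ∀ active new es → Biased (attempts G active new es)
  attempts-biased active new []       = tt
  attempts-biased active new (e ∷ es) =
    Biased-bind (attempts G active new es) (attempts-biased active new es) one
    where
    one : ∀ hit → Biased (if does (src e ∈? new) ∧ not (does (tgt e ∈? active))
      then flip (weight e) (return (⁅ tgt e ⁆ ∪ hit)) (return hit) else return hit)
    one hit with does (src e ∈? new) ∧ not (does (tgt e ∈? active))
    ... | true  = (weight>0 e , weight≤1 e) , tt , tt
    ... | false = tt

  cascade-biased : ∀ t active new → Biased (cascade G t active new)
  cascade-biased zero    active new = tt
  cascade-biased (suc t) active new =
    Biased-bind (attempts G active new (allFin m)) (attempts-biased active new (allFin m))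
      λ hit → cascade-biased t (active ∪ hit) hit

  p-inUnit : ∀ v X → InUnit (p G v X)
  p-inUnit v X = Pr-inUnit _ (cascade G n X X) (cascade-biased n X X)

  module _ (L R : ℚ → Set) where

    -- `L` marks the edges whose attempt may succeed, `R` those whose attempt may fail. Thus
    -- `caused` bounds the hits from above by edges with `L`, and `complete` from below by edges
    -- without `R`.
    record Hits (active new : Subset n) (es : List (Fin m)) (hit : Subset n) : Set where
      field
        caused   : ∀ {v} → v ∈ hit → ∃[ e ] L (weight e) × src e ∈ new × tgt e ≡ v
        inactive : ∀ {v} → v ∈ hit → v ∉ active
        complete : ∀ {e} → e L.∈ es → ¬ R (weight e) → src e ∈ new → tgt e ∉ active → tgt e ∈ hit

    attempts-hits : ∀ active new es → Always L R (Hits active new es) (attempts G active new es)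
    attempts-hits active new [] = record
      { caused = ⊥-elim ∘ ∉⊥ ; inactive = ⊥-elim ∘ ∉⊥ ; complete = λ () }
    attempts-hits active new (e ∷ es) =
      Always-bind (attempts G active new es) (attempts-hits active new es) one
      where
      one : ∀ hit → Hits active new es hit → Always L R (Hits active new (e ∷ es))
        (if does (src e ∈? new) ∧ not (does (tgt e ∈? active))
           then flip (weight e) (return (⁅ tgt e ⁆ ∪ hit)) (return hit) else return hit)
      one hit h with src e ∈? new | tgt e ∈? active
      ... | no s∉ | _ = record
        { Hits h hiding (complete)
        ; complete = λ { (here refl) _ s∈ → contradiction s∈ s∉ ; (there e∈) → Hits.complete h e∈ } }
      ... | yes s∈ | yes t∈ = record
        { Hits h hiding (complete)
        ; complete = λ { (here refl) _ _ t∉ → contradiction t∈ t∉ ; (there e∈) → Hits.complete h e∈ } }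
      ... | yes s∈ | no t∉ =
        (λ l → record
          { caused = λ v∈ → [ (λ v∈₁ → e , l , s∈ , sym (x∈⁅y⁆⇒x≡y _ v∈₁)) , Hits.caused h ]′ (x∈p∪q⁻ _ _ v∈)
          ; inactive = λ v∈ → [ (λ v∈₁ → subst (_∉ active) (sym (x∈⁅y⁆⇒x≡y _ v∈₁)) t∉) , Hits.inactive h ]′ (x∈p∪q⁻ _ _ v∈)
          ; complete = λ { (here refl) _ _ _ → x∈p∪q⁺ (inj₁ (x∈⁅x⁆ _))
                         ; (there e∈) ¬r s t → x∈p∪q⁺ (inj₂ (Hits.complete h e∈ ¬r s t)) } }) ,
        (λ r → record
          { Hits h hiding (complete)
          ; complete = λ { (here refl) ¬r → contradiction r ¬r ; (there e∈) → Hits.complete h e∈ } })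

    record Outcome (X S : Subset n) : Set where
      field
        start  : X ⊆ S
        reach  : ∀ {v} → v ∈ S → ∃[ x ] x ∈ X × Star (Step L) x v
        closed : ∀ e → ¬ R (weight e) → src e ∈ S → tgt e ∈ S

    -- Here `t` counts the remaining steps. `progress` is the reason why n steps suffice: a step
    -- either activates a further node, which preserves the inequality, or leaves `new` empty from
    -- then on; at `t = 0` the inequality says that all nodes are active.
    record Running (X : Subset n) (t : ℕ) (active new : Subset n) : Set where
      field
        start    : X ⊆ active
        reach    : ∀ {v} → v ∈ active → ∃[ x ] x ∈ X × Star (Step L) x v
        new⊆     : new ⊆ active
        frontier : ∀ e → ¬ R (weight e) → src e ∈ active → src e ∈ new ⊎ tgt e ∈ active
        progress : n ℕ.≤ t ℕ.+ ∣ active ∣ ⊎ Empty new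

    Running-stop : ∀ {X active new} → Running X 0 active new → Outcome X active
    Running-stop {active = active} r = record
      { start = start ; reach = reach ; closed = λ e ¬r s∈ → closed e (frontier e ¬r s∈) }
      where
      open Running r
      closed : ∀ e → _ ⊎ tgt e ∈ active → tgt e ∈ active
      closed e (inj₂ t∈) = t∈
      closed e (inj₁ s∈) with progress
      ... | inj₁ n≤ = subst (tgt e ∈_) (sym (∣p∣≡n⇒p≡⊤ (ℕ.≤-antisym (∣p∣≤n active) n≤))) ∈⊤
      ... | inj₂ ∅  = contradiction (_ , s∈) ∅

    Running-step : ∀ {X t active new hit} → Running X (suc t) active new →
           Hits active new (allFin m) hit → Running X t (active ∪ hit) hit
    Running-step {X} {t} {active} {new} {hit} r h = record
      { start = λ x∈ → p⊆p∪q hit (start x∈)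
      ; reach = λ v∈ → [ reach , extend ]′ (x∈p∪q⁻ active hit v∈)
      ; new⊆ = λ v∈ → x∈p∪q⁺ (inj₂ v∈)
      ; frontier = λ e ¬r s∈ → [ (λ s∈a → old e ¬r (frontier e ¬r s∈a)) , inj₁ ]′ (x∈p∪q⁻ active hit s∈)
      ; progress = grow (nonempty? hit)
      }
      where
      open Running r
      open Hits h
      extend : ∀ {v} → v ∈ hit → ∃[ x ] x ∈ X × Star (Step L) x v
      extend v∈ with caused v∈
      ... | e , l , s∈ , refl with reach (new⊆ s∈)
      ... | x , x∈ , path = x , x∈ , path ◅◅ ((e , l , refl , refl) ◅ ε)
      old : ∀ e → ¬ R (weight e) → src e ∈ new ⊎ tgt e ∈ active → src e ∈ hit ⊎ tgt e ∈ active ∪ hit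
      old e ¬r (inj₂ t∈) = inj₂ (p⊆p∪q hit t∈)
      old e ¬r (inj₁ s∈) with tgt e ∈? active
      ... | yes t∈ = inj₂ (p⊆p∪q hit t∈)
      ... | no t∉  = inj₂ (x∈p∪q⁺ (inj₂ (complete (∈-allFin e) ¬r s∈ t∉)))
      grow : Dec (Nonempty hit) → n ℕ.≤ t ℕ.+ ∣ active ∪ hit ∣ ⊎ Empty hit
      grow (no ∅) = inj₂ ∅
      grow (yes (v , v∈)) with progress
      ... | inj₂ ∅ = contradiction (let e , _ , s∈ , _ = caused v∈ in _ , s∈) ∅
      ... | inj₁ n≤ = inj₁ (ℕ.≤-trans n≤ (ℕ.≤-trans (ℕ.≤-reflexive (sym (ℕ.+-suc t ∣ active ∣)))
              (ℕ.+-monoʳ-≤ t (p⊂q⇒∣p∣<∣q∣ (p⊆p∪q hit , v , x∈p∪q⁺ (inj₂ v∈) , inactive v∈)))))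

    cascade-running : ∀ {X} t {active new} → Running X t active new →
                      Always L R (Outcome X) (cascade G t active new)
    cascade-running zero    r = Running-stop r
    cascade-running (suc t) {active} {new} r =
      Always-bind (attempts G active new (allFin m)) (attempts-hits active new (allFin m))
        λ hit h → cascade-running t (Running-step r h)

    cascade-outcome : ∀ X → Always L R (Outcome X) (cascade G n X X)
    cascade-outcome X = cascade-running n record
      { start = λ x∈ → x∈ ; reach = λ v∈ → _ , v∈ , ε ; new⊆ = λ v∈ → v∈
      ; frontier = λ _ _ → inj₁ ; progress = inj₁ (ℕ.m≤m+n n ∣ X ∣) }

  Outcome-path : ∀ {L R X S u v} → Outcome L R X S → (∀ {q} → Certain q → ¬ R q) →
                 Star (Step Certain) u v → u ∈ S → v ∈ S
  Outcome-path o _  ε u∈ = u∈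
  Outcome-path o ¬r ((e , w≡1 , refl , refl) ◅ path) u∈ =
    Outcome-path o ¬r path (Outcome.closed o e (¬r w≡1) u∈)

  module _ {S : Subset n} {f : Fin n → ℚ} where

    private
      total : List (Fin n) → ℚ
      total vs = foldr ℚ._+_ 0ℚ (map f vs)

      total≥0 : (∀ v → 0ℚ ℚ.≤ f v) → ∀ vs → 0ℚ ℚ.≤ total vs
      total≥0 f≥0 []       = ℚ.≤-refl
      total≥0 f≥0 (v ∷ vs) = ℚ.+-mono-≤ (f≥0 v) (total≥0 f≥0 vs)

    sumOver≥0 : (∀ v → 0ℚ ℚ.≤ f v) → 0ℚ ℚ.≤ sumOver G S f
    sumOver≥0 f≥0 = total≥0 f≥0 (filter (_∈? S) (allFin n))

    sumOver≤0⇒ : (∀ v → 0ℚ ℚ.≤ f v) → sumOver G S f ℚ.≤ 0ℚ → ∀ {v} → v ∈ S → f v ≡ 0ℚ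
    sumOver≤0⇒ f≥0 sum≤0 {v} v∈S =
      ℚ.≤-antisym (ℚ.≤-trans (go _ (∈-filter⁺ (_∈? S) (∈-allFin v) v∈S)) sum≤0) (f≥0 v)
      where
      go : ∀ vs → v L.∈ vs → f v ℚ.≤ total vs
      go (u ∷ us) (here refl) =
        subst (ℚ._≤ total (u ∷ us)) (ℚ.+-identityʳ (f v)) (ℚ.+-monoʳ-≤ (f v) (total≥0 f≥0 us))
      go (u ∷ us) (there v∈)  =
        subst (ℚ._≤ total (u ∷ us)) (ℚ.+-identityˡ (f v)) (ℚ.+-mono-≤ (f≥0 u) (go us v∈))

    sumOver≡0 : (∀ {v} → v ∈ S → f v ≡ 0ℚ) → sumOver G S f ≡ 0ℚ
    sumOver≡0 f≡0 = go _ λ v∈ → f≡0 (proj₂ (∈-filter⁻ (_∈? S) {xs = allFin n} v∈))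
      where
      go : ∀ vs → (∀ {v} → v L.∈ vs → f v ≡ 0ℚ) → total vs ≡ 0ℚ
      go []       _  = refl
      go (v ∷ vs) eq = cong₂ ℚ._+_ (eq (here refl)) (go vs (eq ∘ there))

  ClosedUnderEdges : Subset n → Set
  ClosedUnderEdges A = ∀ e → src e ∈ A → tgt e ∈ A

  record ZeroCost (A X : Subset n) : Set where
    field
      within : X ⊆ A
      closed : ClosedUnderEdges A
      covers : ∀ {v} → v ∈ A → ∃[ x ] x ∈ X × Star (Step Certain) x v

  ZeroCost⇒C≡0 : ∀ {A X} → ZeroCost A X → C G A X ≡ 0ℚ
  ZeroCost⇒C≡0 {A} {X} z = cong₂ ℚ._+_
    (sumOver≡0 {S = A} λ v∈A → cong (ℚ._-_ 1ℚ) (p≡1 v∈A))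
    (sumOver≡0 {S = ∁ A} λ v∈∁A → p≡0 (x∈∁p⇒x∉p v∈∁A))
    where
    open ZeroCost z
    stay : ∀ {u v} → Star (Step Any) u v → u ∈ A → v ∈ A
    stay ε u∈ = u∈
    stay ((e , _ , refl , refl) ◅ path) u∈ = stay path (closed e u∈)
    p≡1 : ∀ {v} → v ∈ A → p G v X ≡ 1ℚ
    p≡1 {v} v∈A = Pr-always _ true (cascade G n X X)
      (Always-map (cascade G n X X)
        (λ S o → let x , x∈X , path = covers v∈A in dec-true (v ∈? S) (Outcome-path o (λ w≡1 w≢1 → w≢1 w≡1) path (Outcome.start o x∈X)))
        (cascade-outcome Any Uncertain X))
    p≡0 : ∀ {v} → v ∉ A → p G v X ≡ 0ℚ
    p≡0 {v} v∉A = Pr-always _ false (cascade G n X X)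
      (Always-map (cascade G n X X)
        (λ S o → dec-false (v ∈? S) λ v∈S → let x , x∈X , path = Outcome.reach o v∈S in v∉A (stay path (within x∈X)))
        (cascade-outcome Any Uncertain X))

  -- All terms of both sums are nonnegative, so each vanishes. `covers` is read off the outcome in
  -- which only certain attempts succeed, `within` and `closed` off the one in which all succeed:
  -- whatever lies in the latter has positive probability and therefore belongs to A.
  C≤0⇒ZeroCost : ∀ {A X} → C G A X ℚ.≤ 0ℚ → ZeroCost A X
  C≤0⇒ZeroCost {A} {X} C≤0 = record { within = within ; closed = closed ; covers = covers }
    where
    inA≥0 : ∀ v → 0ℚ ℚ.≤ 1ℚ ℚ.- p G v X
    inA≥0 v = x≤y⇒0≤y-x (proj₂ (p-inUnit v X))
    out≥0 : ∀ v → 0ℚ ℚ.≤ p G v X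
    out≥0 v = proj₁ (p-inUnit v X)
    ΣA ΣV∖A : ℚ
    ΣA   = sumOver G A (λ v → 1ℚ ℚ.- p G v X)
    ΣV∖A = sumOver G (∁ A) (λ v → p G v X)
    p≡1 : ∀ {v} → v ∈ A → p G v X ≡ 1ℚ
    p≡1 {v} v∈A = sym (trans (rearrange (p G v X)) (trans
      (cong (ℚ._+ p G v X) (sumOver≤0⇒ inA≥0 (ℚ.≤-trans ΣA≤C C≤0) v∈A)) (ℚ.+-identityˡ _)))
      where
      rearrange : ∀ x → 1ℚ ≡ (1ℚ ℚ.- x) ℚ.+ x
      rearrange = solve 1 (λ x → con 1ℚ := (con 1ℚ :- x) :+ x) refl
        where open +-*-Solver
      ΣA≤C : ΣA ℚ.≤ C G A X
      ΣA≤C = subst (ℚ._≤ C G A X) (ℚ.+-identityʳ ΣA) (ℚ.+-monoʳ-≤ ΣA (sumOver≥0 {S = ∁ A} out≥0))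
    p≡0 : ∀ {v} → v ∉ A → p G v X ≡ 0ℚ
    p≡0 {v} v∉A = sumOver≤0⇒ out≥0 (ℚ.≤-trans Σ≤C C≤0) (x∉p⇒x∈∁p v∉A)
      where
      Σ≤C : ΣV∖A ℚ.≤ C G A X
      Σ≤C = subst (ℚ._≤ C G A X) (ℚ.+-identityˡ ΣV∖A) (ℚ.+-monoˡ-≤ ΣV∖A (sumOver≥0 {S = A} inA≥0))
    p≢0 : ∀ {v} → (∀ {S} → Outcome Any Never X S → v ∈ S) → v ∈ A
    p≢0 {v} v∈ with v ∈? A
    ... | yes v∈A = v∈A
    ... | no v∉A =
      let S , o , v∉S = Pr≡0⇒witness {Q = Outcome Any Never X} (cascade G n X X)
                          (cascade-biased n X X) (cascade-outcome Any Never X) (p≡0 v∉A)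
      in contradiction (v∈ o) (does-false⇒∉ S v∉S)
    within : X ⊆ A
    within x∈X = p≢0 λ o → Outcome.start o x∈X
    covers : ∀ {v} → v ∈ A → ∃[ x ] x ∈ X × Star (Step Certain) x v
    covers v∈A =
      let S , o , v∈S = Pr≡1⇒witness {Q = Outcome Certain Uncertain X} (cascade G n X X)
                          (cascade-biased n X X) (cascade-outcome Certain Uncertain X) (p≡1 v∈A)
      in Outcome.reach o (does-true⇒∈ S v∈S)
    closed : ClosedUnderEdges A
    -- `covers` brings `src e` into the outcome in which all attempts succeed, and that set is
    -- closed under all edges.
    closed e s∈A = p≢0 λ o → let _ , x∈X , path = covers s∈A in
      Outcome.closed o e (λ ()) (Outcome-path o (λ _ ()) path (Outcome.start o x∈X))

-- A Hoare logic with running times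

-- Loops are left to while-run: wp is false and size is 0 on them.
wp : Program → (State → Set) → State → Set
wp skip         Q σ = Q σ
wp (instr i)    Q σ = Q (exec i σ)
wp (P₁ ⨾ P₂)    Q σ = wp P₁ (wp P₂ Q) σ
wp (ifte B P₁ P₂) Q σ = (eval B σ ≡ true → wp P₁ Q σ) × (eval B σ ≡ false → wp P₂ Q σ)
wp (while _ _)  Q σ = Empty.⊥

wp-mono : ∀ P {Q Q′ : State → Set} {σ} → (∀ {τ} → Q τ → Q′ τ) → wp P Q σ → wp P Q′ σ
wp-mono skip           f q         = f q
wp-mono (instr _)      f q         = f q
wp-mono (P₁ ⨾ P₂)      f w         = wp-mono P₁ (wp-mono P₂ f) w
wp-mono (ifte _ P₁ P₂) f (w₁ , w₂) = (λ eq → wp-mono P₁ f (w₁ eq)) , (λ eq → wp-mono P₂ f (w₂ eq))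

size : Program → ℕ
size skip           = 0
size (instr _)      = 1
size (P₁ ⨾ P₂)      = size P₁ + size P₂
size (ifte _ P₁ P₂) = suc (size P₁ + size P₂)
size (while _ _)    = 0

Run : Program → State → ℕ → (State → Set) → Set
Run P σ k Q = ∃[ t ] ∃[ τ ] ⟨ P , σ ⟩⇓[ t ] τ × t ≤ k × Q τ

wp-run : ∀ P {Q σ} → wp P Q σ → Run P σ (size P) Q
wp-run skip         q = 0 , _ , skip⇓ , ℕ.≤-refl , q
wp-run (instr i)    q = 1 , _ , instr⇓ , ℕ.≤-refl , q
wp-run (P₁ ⨾ P₂)    w =
  let s , τ , r₁ , s≤ , w₂ = wp-run P₁ w
      t , υ , r₂ , t≤ , q  = wp-run P₂ w₂
  in s + t , υ , seq⇓ r₁ r₂ , ℕ.+-mono-≤ s≤ t≤ , q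
wp-run (ifte B P₁ P₂) {σ = σ} (w₁ , w₂) with eval B σ in eq
... | true  = let t , τ , r , t≤ , q = wp-run P₁ (w₁ refl)
              in suc t , τ , if-yes⇓ eq r , s≤s (ℕ.≤-trans t≤ (ℕ.m≤m+n _ _)) , q
... | false = let t , τ , r , t≤ , q = wp-run P₂ (w₂ refl)
              in suc t , τ , if-no⇓ eq r , s≤s (ℕ.≤-trans t≤ (ℕ.m≤n+m _ _)) , q

-- The index of the invariant is a potential that every iteration decreases.
while-run : ∀ {B P} (Inv : ℕ → State → Set) →
            (∀ {k σ} → Inv k σ → eval B σ ≡ true → wp P (λ τ → ∃[ j ] j < k × Inv j τ) σ) →
            ∀ {k σ} → Inv k σ →
            Run (while B P) σ (suc (k * suc (size P))) (λ τ → ∃[ j ] Inv j τ × eval B τ ≡ false)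
while-run {B} {P} Inv body {k} inv = go (<-wellFounded k) inv
  where
  go : ∀ {k σ} → Acc _<_ k → Inv k σ →
       Run (while B P) σ (suc (k * suc (size P))) (λ τ → ∃[ j ] Inv j τ × eval B τ ≡ false)
  go {k} {σ} (acc smaller) inv with eval B σ in eq
  ... | false = 1 , σ , exit⇓ eq , s≤s z≤n , k , inv , eq
  ... | true  =
    let s , τ , r , s≤ , j , j<k , inv′ = wp-run P (body inv eq)
        t , υ , r′ , t≤ , q = go (smaller j<k) inv′
    in suc (s + t) , υ , loop⇓ eq r r′ ,
       s≤s (ℕ.≤-trans (ℕ.+-mono-≤ s≤ t≤) (ℕ.≤-trans (ℕ.≤-reflexive (ℕ.+-suc (size P) (j * suc (size P))))
         (ℕ.*-monoˡ-≤ (suc (size P)) j<k))) , q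

-- Counting from 1 makes `leq` stop the loop after exactly `bound` iterations. In a loop over edges
-- the counter is then also the address of the current weight, as `c` occupies cell 0, and the
-- non-null pointer to the current edge.
for : (i bound one : Reg) → Program → Program
for i bound one P = instr (const i 1) ⨾ while (leq i bound) (P ⨾ instr (add i i one))

-- The cost that straight, loop and _⊕_ compute for it.
cost-for : Program → ℕ
cost-for P = 1 + suc (1 * suc (size P + 1))

-- Times are measured in multiples of `N`, so that the factors are independent of the instance and
-- add up under sequencing. `1≤N` allows constant-time code to be charged in this unit.
module Hoare (N : ℕ) (1≤N : 1 ≤ N) where

  record Triple (Pre : State → Set) (P : Program) (k : ℕ) (Post : State → Set) : Set where
    constructor triple
    field run : ∀ {σ} → Pre σ → Run P σ (k * N) Post

  open Triple public

  straight : ∀ {Pre Post} P → (∀ {σ} → Pre σ → wp P Post σ) → Triple Pre P (size P) Post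
  straight P w = triple λ pre →
    let t , τ , r , t≤ , q = wp-run P (w pre)
    in t , τ , r , ℕ.≤-trans t≤ (ℕ.≤-trans (ℕ.≤-reflexive (sym (ℕ.*-identityʳ (size P)))) (ℕ.*-monoʳ-≤ (size P) 1≤N)) , q

  infixr 5 _⊕_

  _⊕_ : ∀ {P₁ P₂ k₁ k₂ Pre Mid Post} → Triple Pre P₁ k₁ Mid → Triple Mid P₂ k₂ Post →
        Triple Pre (P₁ ⨾ P₂) (k₁ + k₂) Post
  _⊕_ {k₁ = k₁} {k₂} h₁ h₂ = triple λ pre →
    let s , τ , r₁ , s≤ , mid = run h₁ pre
        t , υ , r₂ , t≤ , q   = run h₂ mid
    in s + t , υ , seq⇓ r₁ r₂ , ℕ.≤-trans (ℕ.+-mono-≤ s≤ t≤) (ℕ.≤-reflexive (sym (ℕ.*-distribʳ-+ N k₁ k₂))) , q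

  loop : ∀ {B P Pre Post} (Inv : ℕ → State → Set) c →
         (∀ {σ} → Pre σ → ∃[ k ] k ≤ c * N × Inv k σ) →
         (∀ {k σ} → Inv k σ → eval B σ ≡ true → wp P (λ τ → ∃[ j ] j < k × Inv j τ) σ) →
         (∀ {k σ} → Inv k σ → eval B σ ≡ false → Post σ) →
         Triple Pre (while B P) (suc (c * suc (size P))) Post
  loop {B} {P} Inv c enter body leave = triple λ pre →
    let k , k≤ , inv = enter pre
        t , τ , r , t≤ , j , inv′ , eq = while-run Inv body inv
    in t , τ , r , ℕ.≤-trans t≤ (bound k k≤) , leave inv′ eq
    where
    open ℕ.≤-Reasoning
    open ℕ-Solver.+-*-Solver
    s = suc (size P)
    bound : ∀ k → k ≤ c * N → suc (k * s) ≤ suc (c * s) * N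
    bound k k≤ = begin
      1 + k * s           ≤⟨ ℕ.+-mono-≤ 1≤N (ℕ.*-monoˡ-≤ s k≤) ⟩
      N + c * N * s       ≡⟨ solve 3 (λ N c s → N :+ c :* N :* s := (con 1 :+ c :* s) :* N) refl N c s ⟩
      suc (c * s) * N     ∎

  -- The potential is the number of iterations left. Passing the iteration to `body` as an element
  -- of `Fin M` hands it the current node or edge directly.
  for-loop : ∀ {i bound one P Pre Post} (Inv : ℕ → State → Set) (M : ℕ) → M ≤ N →
             (∀ {j σ} → Inv j σ → State.reg σ i ≡ suc j × State.reg σ bound ≡ M) →
             (∀ {σ} → Pre σ → Inv 0 (exec (const i 1) σ)) →
             (∀ {σ} (j : Fin M) → Inv (toℕ j) σ → wp P (λ τ → Inv (suc (toℕ j)) (exec (add i i one) τ)) σ) →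
             (∀ {σ} → Inv M σ → Post σ) →
             Triple Pre (for i bound one P) (cost-for P) Post
  for-loop {i} {bound} {one} {P} Inv M M≤N regs enter body leave =
    straight (instr (const i 1)) enter ⊕
    loop {B = leq i bound} {P = P ⨾ instr (add i i one)} Inv′ 1
      (λ inv → M , ℕ.≤-trans M≤N (ℕ.≤-reflexive (sym (ℕ.+-identityʳ N))) , 0 , refl , inv)
      step
      finish
    where
    Inv′ : ℕ → State → Set
    Inv′ k σ = ∃[ j ] j + k ≡ M × Inv j σ
    step : ∀ {k σ} → Inv′ k σ → eval (leq i bound) σ ≡ true →
           wp (P ⨾ instr (add i i one)) (λ τ → ∃[ k′ ] k′ < k × Inv′ k′ τ) σ
    step {zero} {σ} (j , eq , inv) test = contradiction
      (subst₂ _≤_ (proj₁ (regs inv)) (trans (proj₂ (regs inv)) (trans (sym eq) (ℕ.+-identityʳ j)))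
        (ℕ.≤ᵇ⇒≤ (State.reg σ i) (State.reg σ bound) (subst T (sym test) tt)))
      ℕ.1+n≰n
    step {suc k} {σ} (j , eq , inv) _ = wp-mono P
      (λ inv′ → k , ℕ.≤-refl , suc j , trans (sym (ℕ.+-suc j k)) eq , subst (λ x → Inv (suc x) _) toℕ-j inv′)
      (body (fromℕ< j<M) (subst (λ x → Inv x σ) (sym toℕ-j) inv))
      where
      j<M : j < M
      j<M = subst (j <_) eq (ℕ.m<m+n j (s≤s z≤n))
      toℕ-j : toℕ (fromℕ< j<M) ≡ j
      toℕ-j = Fin.toℕ-fromℕ< j<M
    finish : ∀ {k σ} → Inv′ k σ → eval (leq i bound) σ ≡ false → _
    finish {zero} {σ} (j , eq , inv) _ = leave (subst (λ x → Inv x σ) (trans (sym (ℕ.+-identityʳ j)) eq) inv)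
    finish {suc k} {σ} (j , eq , inv) test = contradiction
      (ℕ.≤⇒≤ᵇ (subst₂ _≤_ (sym (proj₁ (regs inv))) (sym (proj₂ (regs inv))) (subst (j <_) eq (ℕ.m<m+n j (s≤s z≤n)))))
      (subst T test)

-- Selecting nodes by two rounds of graph search

∣p∪q∣≤∣p∣+∣q∣ : ∀ {n} (p q : Subset n) → ∣ p ∪ q ∣ ≤ ∣ p ∣ + ∣ q ∣
∣p∪q∣≤∣p∣+∣q∣ [] [] = z≤n
∣p∪q∣≤∣p∣+∣q∣ (outside ∷ p) (outside ∷ q) = ∣p∪q∣≤∣p∣+∣q∣ p q
∣p∪q∣≤∣p∣+∣q∣ (outside ∷ p) (inside ∷ q)  =
  ℕ.≤-trans (s≤s (∣p∪q∣≤∣p∣+∣q∣ p q)) (ℕ.≤-reflexive (sym (ℕ.+-suc ∣ p ∣ ∣ q ∣)))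
∣p∪q∣≤∣p∣+∣q∣ (inside ∷ p) (outside ∷ q)  = s≤s (∣p∪q∣≤∣p∣+∣q∣ p q)
∣p∪q∣≤∣p∣+∣q∣ (inside ∷ p) (inside ∷ q)   =
  s≤s (ℕ.≤-trans (∣p∪q∣≤∣p∣+∣q∣ p q) (ℕ.+-monoʳ-≤ ∣ p ∣ (ℕ.n≤1+n ∣ q ∣)))

fromList : ∀ {n} → List (Fin n) → Subset n
fromList = foldr (λ v S → ⁅ v ⁆ ∪ S) Subset.⊥

∣fromList∣≤length : ∀ {n} (vs : List (Fin n)) → ∣ fromList vs ∣ ≤ length vs
∣fromList∣≤length {n} []       = ℕ.≤-reflexive (∣⊥∣≡0 n)
∣fromList∣≤length     (v ∷ vs) = ℕ.≤-trans (∣p∪q∣≤∣p∣+∣q∣ ⁅ v ⁆ (fromList vs))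
  (ℕ.+-mono-≤ (ℕ.≤-reflexive (∣⁅x⁆∣≡1 v)) (∣fromList∣≤length vs))

∈-fromList⁺ : ∀ {n} {v : Fin n} {vs} → v L.∈ vs → v ∈ fromList vs
∈-fromList⁺ {v = v} (here refl) = x∈p∪q⁺ (inj₁ (x∈⁅x⁆ v))
∈-fromList⁺ (there v∈)          = x∈p∪q⁺ (inj₂ (∈-fromList⁺ v∈))

∈-fromList⁻ : ∀ {n} {v : Fin n} vs → v ∈ fromList vs → v L.∈ vs
∈-fromList⁻ []       v∈ = ⊥-elim (∉⊥ v∈)
∈-fromList⁻ (u ∷ us) v∈ with x∈p∪q⁻ ⁅ u ⁆ (fromList us) v∈
... | inj₁ v∈u  = here (x∈⁅y⁆⇒x≡y u v∈u)
... | inj₂ v∈us = there (∈-fromList⁻ us v∈us)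

-- Pigeonhole by induction: the representative of the head is removed from X, and no later entry
-- loses its own, since no element of X represents two entries.
length≤∣X∣ : ∀ {n} {V : Set} {Rep : Fin n → V → Set} (vs : List V) (X : Subset n) →
             All (λ v → ∃[ x ] x ∈ X × Rep x v) vs →
             AllPairs (λ v w → ∀ x → x ∈ X → Rep x v → Rep x w → Empty.⊥) vs →
             length vs ≤ ∣ X ∣
length≤∣X∣ []       X _ _ = z≤n
length≤∣X∣ (v ∷ vs) X ((x , x∈X , xv) ∷ reps) (v# ∷ #vs) =
  ℕ.≤-<-trans (length≤∣X∣ vs (X - x)
      (All.zipWith (λ { ((y , y∈X , yw) , vw) →
        y , x∈p∧x≢y⇒x∈p-y y∈X (λ { refl → vw x x∈X xv yw }) , yw }) (reps , v#))
      (AllPairs.map (λ # y y∈ → # y (p─q⊆p X ⁅ x ⁆ y∈)) #vs))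
    (x∈p⇒∣p-x∣<∣p∣ x∈X)

subset : ∀ {n} → (Fin n → Bool) → Subset n
subset = Vec.tabulate

∈-subset⁺ : ∀ {n} {f : Fin n → Bool} {v} → T (f v) → v ∈ subset f
∈-subset⁺ {f = f} {v} fv = lookup⇒[]= v (subset f) (trans (lookup∘tabulate f v) (Equivalence.to T-≡ fv))

∈-subset⁻ : ∀ {n} {f : Fin n → Bool} {v} → v ∈ subset f → T (f v)
∈-subset⁻ {f = f} {v} v∈ = subst T (trans (sym ([]=⇒lookup v∈)) (lookup∘tabulate f v)) tt

-- The cases are equations in `Fin n`, hence between nodes or edges, and the predicate lets one case
-- split serve values, bounds and pointers alike.
≔-elim : ∀ {n} {A : Set} (P : A → Set) (f : ℕ → A) (u v : Fin n) {x} →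
         (v ≡ u → P x) → (v ≢ u → P (f (toℕ v))) → P ((f [ toℕ u ≔ x ]) (toℕ v))
≔-elim P f u v eq neq with toℕ v ℕ.≡ᵇ toℕ u in test
... | true  = eq (Fin.toℕ-injective (ℕ.≡ᵇ⇒≡ (toℕ v) (toℕ u) (subst T (sym test) tt)))
... | false = neq λ { refl → subst T test (ℕ.≡⇒≡ᵇ (toℕ v) (toℕ v) refl) }

≔-same : ∀ {A : Set} (f : ℕ → A) i {x} → (f [ i ≔ x ]) i ≡ x
≔-same f i with i ℕ.≡ᵇ i in test
... | true  = refl
... | false = ⊥-elim (subst T test (ℕ.≡⇒≡ᵇ i i refl))

≔-other : ∀ {A : Set} (f : ℕ → A) {i j x} → j ≢ i → (f [ i ≔ x ]) j ≡ f j
≔-other f {i} {j} j≢i with j ℕ.≡ᵇ i in test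
... | true  = contradiction (ℕ.≡ᵇ⇒≡ j i (subst T (sym test) tt)) j≢i
... | false = refl

-- Edge lists and invariants of the search

module Searching {n m : ℕ} (G : InfluenceGraph n m) where
  open InfluenceGraph G

  infix 4 _⟶*_

  _⟶*_ : Fin n → Fin n → Set
  _⟶*_ = Star (Step G Certain)

  Sure : Fin m → Set
  Sure e = weight e ≡ 1ℚ

  edge : ∀ {e} → Sure e → src e ⟶* tgt e
  edge s = (_ , s , refl , refl) ◅ ε

  -- The edge numbered e is represented by the pointer suc e, and 0 is the null pointer.
  Pointer : Fin n → ℕ → Set
  Pointer u h = h ≡ 0 ⊎ ∃[ e ] h ≡ suc (toℕ e) × Sure e × src e ≡ u

  -- Pointers are shifted by one, so `earlier` says that the successor of `e` has a smaller number
  -- than `e`, and `latest` that no sure edge with the same source lies between them. Decreasing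
  -- numbers give termination, the absence of gaps gives completeness, and lists need not be
  -- described as sequences.
  record Nexts (j : ℕ) (next : ℕ → ℕ) : Set where
    field
      pointer  : ∀ e → toℕ e < j → Sure e → Pointer (src e) (next (toℕ e))
      earlier  : ∀ e → toℕ e < j → Sure e → next (toℕ e) ≤ toℕ e
      latest   : ∀ e d → toℕ e < j → Sure e → Sure d → src d ≡ src e → toℕ d < toℕ e →
                 toℕ d < next (toℕ e)

  record Lists (j : ℕ) (head next : ℕ → ℕ) : Set where
    field
      nexts   : Nexts j next
      pointer : ∀ u → Pointer u (head (toℕ u))
      earlier : ∀ (u : Fin n) → head (toℕ u) ≤ j
      latest  : ∀ e → toℕ e < j → Sure e → toℕ e < head (toℕ (src e))

  Lists-empty : ∀ {head next} → (∀ v → head (toℕ {n} v) ≡ 0) → Lists 0 head next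
  Lists-empty h≡0 = record
    { nexts = record { pointer = λ _ () ; earlier = λ _ () ; latest = λ _ _ () }
    ; pointer = inj₁ ∘ h≡0 ; earlier = ℕ.≤-reflexive ∘ h≡0 ; latest = λ _ () }

  private
    below : ∀ {d e : Fin m} → toℕ d < suc (toℕ e) → d ≢ e → toℕ d < toℕ e
    below d< d≢e = ℕ.≤∧≢⇒< (ℕ.≤-pred d<) (d≢e ∘ Fin.toℕ-injective)

  Lists-skip : ∀ e {head next} → ¬ Sure e → Lists (toℕ e) head next → Lists (suc (toℕ e)) head next
  Lists-skip e {head} {next} ¬s l = record
    { nexts = record
      { pointer = λ d d< s → N.pointer d (old d< s) s
      ; earlier = λ d d< s → N.earlier d (old d< s) s
      ; latest = λ d c d< s → N.latest d c (old d< s) s }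
    ; pointer = l.pointer ; earlier = λ u → ℕ.≤-trans (l.earlier u) (ℕ.n≤1+n _)
    ; latest = λ d d< s → l.latest d (old d< s) s }
    where
    module l = Lists l
    module N = Nexts l.nexts
    old : ∀ {d} → toℕ d < suc (toℕ e) → Sure d → toℕ d < toℕ e
    old d< s = below d< λ { refl → ¬s s }

  Lists-cons : ∀ e {head next} → Sure e → Lists (toℕ e) head next →
               Lists (suc (toℕ e)) (head [ toℕ (src e) ≔ suc (toℕ e) ])
                                   (next [ toℕ e ≔ head (toℕ (src e)) ])
  Lists-cons e {head} {next} se l = record
    { nexts = record
      { pointer = λ d d< s → ≔-elim (Pointer (src d)) next e d
          (λ { refl → l.pointer (src e) }) (λ d≢e → N.pointer d (below d< d≢e) s)
      ; earlier = λ d d< s → ≔-elim (_≤ toℕ d) next e d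
          (λ { refl → l.earlier (src e) }) (λ d≢e → N.earlier d (below d< d≢e) s)
      ; latest = λ d c d< s sc c~d c<d → ≔-elim (toℕ c <_) next e d
          (λ { refl → subst (λ u → toℕ c < head (toℕ u)) c~d (l.latest c c<d sc) })
          (λ d≢e → N.latest d c (below d< d≢e) s sc c~d c<d) }
    ; pointer = λ u → ≔-elim (Pointer u) head (src e) u
        (λ { refl → inj₂ (e , refl , se , refl) }) (λ _ → l.pointer u)
    ; earlier = λ u → ≔-elim (_≤ suc (toℕ e)) head (src e) u
        (λ _ → ℕ.≤-refl) (λ _ → ℕ.≤-trans (l.earlier u) (ℕ.n≤1+n _))
    ; latest = λ d d< s → ≔-elim (toℕ d <_) head (src e) (src d)
        (λ _ → d<) (λ src≢ → l.latest d (below d< (src≢ ∘ cong src)) s) }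
    where
    module l = Lists l
    module N = Nexts l.nexts

  Visited : (ℕ → ℕ) → Fin n → Set
  Visited vis v = 1 ≤ vis (toℕ v)

  -- Edge lists are in decreasing order, so the edges not yet examined are those
  -- numbered below the head of their list.
  pending : (ℕ → ℕ) → Subset m
  pending head = subset λ e → toℕ e <ᵇ head (toℕ (src e))

  unvisited : (ℕ → ℕ) → Subset n
  unvisited vis = subset λ v → vis (toℕ v) <ᵇ 1

  -- The search consumes the lists: `head` points to the next edge to examine. `done` and
  -- `unfinished` together make the visited set closed once the stack is empty, and `room` keeps the
  -- stack within its array.
  record Explore (head vis next : ℕ → ℕ) (st : List (Fin n)) : Set where
    field
      nexts   : Nexts m next
      pointer : ∀ u → Pointer u (head (toℕ u))
      done    : ∀ e → Sure e → toℕ e < head (toℕ (src e)) ⊎ Visited vis (tgt e)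
      unfinished   : ∀ u → Visited vis u → u L.∈ st ⊎ head (toℕ u) ≡ 0
      room    : ∣ unvisited vis ∣ + length st ≤ n

  Visited-mono : ∀ {vis} v {u} → Visited vis u → Visited (vis [ toℕ v ≔ 1 ]) u
  Visited-mono {vis} v {u} vu = ≔-elim (1 ≤_) vis v u (λ _ → ℕ.≤-refl) (λ _ → vu)

  Visited-new : ∀ {vis} v → Visited (vis [ toℕ v ≔ 1 ]) v
  Visited-new {vis} v = ≔-elim (1 ≤_) vis v v (λ _ → ℕ.≤-refl) (λ v≢v → contradiction refl v≢v)

  Visited-old : ∀ {vis} v {u} → Visited (vis [ toℕ v ≔ 1 ]) u → u ≡ v ⊎ Visited vis u
  Visited-old {vis} v {u} = ≔-elim (λ x → 1 ≤ x → u ≡ v ⊎ Visited vis u) vis v u (λ u≡v _ → inj₁ u≡v) (λ _ → inj₂)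

  unvisited-decreases : ∀ {vis v} → ¬ Visited vis v → ∣ unvisited (vis [ toℕ v ≔ 1 ]) ∣ < ∣ unvisited vis ∣
  unvisited-decreases {vis} {v} ¬vv = p⊂q⇒∣p∣<∣q∣
    ( (λ {u} u∈ → ∈-subset⁺ (ℕ.<⇒<ᵇ (ℕ.≰⇒> (¬Visited {vis [ toℕ v ≔ 1 ]} u∈ ∘ Visited-mono {vis} v {u}))))
    , v , ∈-subset⁺ (ℕ.<⇒<ᵇ (ℕ.≰⇒> ¬vv)) , λ v∈ → ¬Visited {vis [ toℕ v ≔ 1 ]} v∈ (Visited-new {vis} v) )
    where
    ¬Visited : ∀ {vis u} → u ∈ unvisited vis → ¬ Visited vis u
    ¬Visited u∈ = ℕ.<⇒≱ (ℕ.<ᵇ⇒< _ _ (∈-subset⁻ u∈))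

  Explore-visit : ∀ {head vis next st v} → Explore head vis next st → ¬ Visited vis v →
                  Explore head (vis [ toℕ v ≔ 1 ]) next (v ∷ st)
  Explore-visit {head} {vis} {st = st} {v = v} x ¬vv = record
    { nexts = nexts ; pointer = pointer
    ; done = λ e s → Sum.map₂ (Visited-mono {vis} v {tgt e}) (done e s)
    ; unfinished = λ u vu → [ (λ u≡v → inj₁ (here u≡v)) , (λ vu → Sum.map₁ there (unfinished u vu)) ]′ (Visited-old {vis} v vu)
    ; room = ℕ.≤-trans (ℕ.≤-reflexive (ℕ.+-suc _ (length st)))
        (ℕ.≤-trans (ℕ.+-monoˡ-≤ (length st) (unvisited-decreases {vis} {v} ¬vv)) room) }
    where open Explore x

  Explore-room : ∀ {head vis next st v} → Explore head vis next st → ¬ Visited vis v → length st < n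
  Explore-room {vis = vis} {st = st} {v} x ¬vv = ℕ.≤-trans
    (s≤s (ℕ.m≤n+m (length st) ∣ unvisited (vis [ toℕ v ≔ 1 ]) ∣))
    (ℕ.≤-trans (ℕ.+-monoˡ-≤ (length st) (unvisited-decreases {vis} {v} ¬vv)) (Explore.room x))

  module _ {head vis next st e} (x : Explore head vis next st) (se : Sure e)
           (h≡e : head (toℕ (src e)) ≡ suc (toℕ e)) where
    open Explore x
    private
      head′ : ℕ → ℕ
      head′ = head [ toℕ (src e) ≔ next (toℕ e) ]
      module N = Nexts nexts

    Explore-consume : Visited vis (tgt e) → src e L.∈ st → Explore head′ vis next st
    Explore-consume vt s∈ = record
      { nexts = nexts
      ; pointer = λ u → ≔-elim (Pointer u) head (src e) u
          (λ { refl → N.pointer e (Fin.toℕ<n e) se }) (λ _ → pointer u)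
      ; done = λ d sd → ≔-elim (λ h → toℕ d < h ⊎ Visited vis (tgt d)) head (src e) (src d)
          (λ d~e → [ rest d sd d~e , inj₂ ]′ (done d sd)) (λ _ → done d sd)
      ; unfinished = λ u vu → ≔-elim (λ h → u L.∈ st ⊎ h ≡ 0) head (src e) u
          (λ { refl → inj₁ s∈ }) (λ _ → unfinished u vu)
      ; room = room }
      where
      -- Advancing the head loses only `e` itself, because `latest` leaves no sure edge of this
      -- source between `next` of `e` and `e`.
      rest : ∀ d → Sure d → src d ≡ src e → toℕ d < head (toℕ (src d)) →
             toℕ d < next (toℕ e) ⊎ Visited vis (tgt d)
      rest d sd d~e d< with d Fin.≟ e
      ... | yes refl = inj₂ vt
      ... | no d≢e   = inj₁ (N.latest e d (Fin.toℕ<n e) se sd d~e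
              (below (subst (toℕ d <_) (trans (cong (head ∘ toℕ) d~e) h≡e) d<) d≢e))

    pending-decreases : ∣ pending head′ ∣ < ∣ pending head ∣
    pending-decreases = p⊂q⇒∣p∣<∣q∣
      ( (λ {d} d∈ → ∈-subset⁺ (ℕ.<⇒<ᵇ (ℕ.<-≤-trans (d<h′ d∈) (h′≤h (src d)))))
      , e , ∈-subset⁺ (ℕ.<⇒<ᵇ (ℕ.≤-reflexive (sym h≡e)))
      , λ e∈ → contradiction (d<h′ e∈) (ℕ.≤⇒≯ (ℕ.≤-trans (ℕ.≤-reflexive (≔-same head (toℕ (src e)))) (N.earlier e (Fin.toℕ<n e) se))) )
      where
      d<h′ : ∀ {d} → d ∈ pending head′ → toℕ d < head′ (toℕ (src d))
      d<h′ = ℕ.<ᵇ⇒< _ _ ∘ ∈-subset⁻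
      h′≤h : ∀ u → head′ (toℕ u) ≤ head (toℕ u)
      h′≤h u = ≔-elim (_≤ head (toℕ u)) head (src e) u
        (λ { refl → ℕ.≤-trans (N.earlier e (Fin.toℕ<n e) se) (ℕ.≤-trans (ℕ.n≤1+n _) (ℕ.≤-reflexive (sym h≡e))) })
        (λ _ → ℕ.≤-refl)

  Explore-pop : ∀ {head vis next u st} → Explore head vis next (u ∷ st) → head (toℕ u) ≡ 0 →
                Explore head vis next st
  Explore-pop {head} {vis} {u = u} {st} x h≡0 = record
    { nexts = nexts ; pointer = pointer ; done = done
    ; unfinished = λ w vw → closed w (unfinished w vw)
    ; room = ℕ.≤-trans (ℕ.+-monoʳ-≤ ∣ unvisited vis ∣ (ℕ.n≤1+n (length st))) room }
    where
    open Explore x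
    closed : ∀ w → w L.∈ u ∷ st ⊎ head (toℕ w) ≡ 0 → w L.∈ st ⊎ head (toℕ w) ≡ 0
    closed w (inj₁ (here refl)) = inj₂ h≡0
    closed w (inj₁ (there w∈))  = inj₁ w∈
    closed w (inj₂ h≡0)         = inj₂ h≡0

  -- With an empty stack every visited node has an exhausted list, so `done` can only say that the
  -- target is visited. This is what keeps a newly selected node unreachable from earlier ones.
  Explore-closed : ∀ {head vis next} → Explore head vis next [] →
                   ∀ {u v} → u ⟶* v → Visited vis u → Visited vis v
  Explore-closed x ε vu = vu
  Explore-closed x ((e , se , refl , refl) ◅ path) vu with Explore.unfinished x (src e) vu | Explore.done x e se
  ... | inj₂ h≡0 | inj₁ e<h = contradiction (subst (toℕ e <_) h≡0 e<h) λ ()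
  ... | inj₂ h≡0 | inj₂ vt  = Explore-closed x path vt

  Explore-start : ∀ {head vis next} → Lists m head next → (∀ v → vis (toℕ {n} v) ≡ 0) → Explore head vis next []
  Explore-start {vis = vis} l v≡0 = record
    { nexts = Lists.nexts l ; pointer = Lists.pointer l
    ; done = λ e se → inj₁ (Lists.latest l e (Fin.toℕ<n e) se)
    ; unfinished = λ u vu → contradiction (subst (1 ≤_) (v≡0 u) vu) λ ()
    ; room = ℕ.≤-trans (ℕ.≤-reflexive (ℕ.+-identityʳ _)) (∣p∣≤n (unvisited vis)) }

  Unreached : Fin n → Fin n → Set
  Unreached v u = ¬ (u ⟶* v)

  module _ (R : Fin n → Fin n → Set) (cs₀ : List (Fin n)) where

    -- `R` relates earlier to later candidates and is carried over to the selected nodes, reversed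
    -- because these are stacked. It is trivial in the first round; in the second it is `Unreached`,
    -- supplied by `fresh` of the first, so that `rs-ord` and the new `fresh` cover both directions.
    record Roots (vis : ℕ → ℕ) (cs rs : List (Fin n)) : Set where
      field
        reached : ∀ v → Visited vis v → ∃[ r ] r L.∈ rs × r ⟶* v
        visited : All (Visited vis) rs
        covered : ∀ {c} → c L.∈ cs₀ → c L.∈ cs ⊎ Visited vis c
        cs⊆     : All (L._∈ cs₀) cs
        rs⊆     : All (L._∈ cs₀) rs
        fresh   : AllPairs Unreached rs
        cs-ord  : AllPairs R cs
        mid-ord : All (λ c → All (λ r → R r c) rs) cs
        rs-ord  : AllPairs (λ u v → R v u) rs
        room    : length cs + length rs ≤ n

    record Selected (rs : List (Fin n)) : Set where
      field
        rs⊆    : All (L._∈ cs₀) rs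
        covers : ∀ {c} → c L.∈ cs₀ → ∃[ r ] r L.∈ rs × r ⟶* c
        fresh  : AllPairs Unreached rs
        rs-ord : AllPairs (λ u v → R v u) rs
        room   : length rs ≤ n

    Roots-start : ∀ {vis} → (∀ v → vis (toℕ {n} v) ≡ 0) → AllPairs R cs₀ → length cs₀ ≤ n → Roots vis cs₀ []
    Roots-start v≡0 ord ≤n = record
      { reached = λ v vv → contradiction (subst (1 ≤_) (v≡0 v) vv) λ ()
      ; visited = [] ; covered = inj₁ ; cs⊆ = All.tabulate (λ c∈ → c∈) ; rs⊆ = [] ; fresh = []
      ; cs-ord = ord ; mid-ord = All.tabulate (λ _ → []) ; rs-ord = []
      ; room = ℕ.≤-trans (ℕ.≤-reflexive (ℕ.+-identityʳ _)) ≤n }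

    Roots-visit : ∀ {vis cs rs r v} → Roots vis cs rs → r L.∈ rs → r ⟶* v → Roots (vis [ toℕ v ≔ 1 ]) cs rs
    Roots-visit {vis} {v = v} x r∈ path = record
      { Roots x hiding (reached; visited; covered)
      ; reached = λ u vu → [ (λ { refl → _ , r∈ , path }) , Roots.reached x u ]′ (Visited-old {vis} v vu)
      ; visited = All.map (λ {u} → Visited-mono {vis} v {u}) (Roots.visited x)
      ; covered = λ {c} c∈ → Sum.map₂ (Visited-mono {vis} v {c}) (Roots.covered x c∈) }

    Roots-drop : ∀ {vis c cs rs} → Roots vis (c ∷ cs) rs → Visited vis c → Roots vis cs rs
    Roots-drop {vis} {c} {cs} x vc = record
      { Roots x hiding (covered; cs⊆; cs-ord; mid-ord; room)
      ; covered = λ d∈ → split (Roots.covered x d∈)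
      ; cs⊆ = All.tail (Roots.cs⊆ x) ; cs-ord = AllPairs.tail (Roots.cs-ord x)
      ; mid-ord = All.tail (Roots.mid-ord x) ; room = ℕ.<⇒≤ (Roots.room x) }
      where
      split : ∀ {d} → d L.∈ c ∷ cs ⊎ Visited vis d → d L.∈ cs ⊎ Visited vis d
      split (inj₁ (here refl)) = inj₂ vc
      split (inj₁ (there d∈))  = inj₁ d∈
      split (inj₂ vd)          = inj₂ vd

    Roots-new : ∀ {head vis next c cs rs} → Roots vis (c ∷ cs) rs → Explore head vis next [] →
                ¬ Visited vis c → Roots (vis [ toℕ c ≔ 1 ]) cs (c ∷ rs)
    Roots-new {vis = vis} {c = c} {cs} {rs} x ex ¬vc = record
      { reached = λ u vu → [ (λ { refl → _ , here refl , ε })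
                           , (λ vu → let r , r∈ , path = reached u vu in r , there r∈ , path) ]′ (Visited-old {vis} c vu)
      ; visited = Visited-new {vis} c ∷ All.map (λ {u} → Visited-mono {vis} c {u}) visited
      ; covered = λ d∈ → split (covered d∈)
      ; cs⊆ = All.tail cs⊆ ; rs⊆ = All.head cs⊆ ∷ rs⊆
      -- A path from an earlier root would stay in the closed visited set and make `c` visited.
      ; fresh = All.map (λ vr path → ¬vc (Explore-closed ex path vr)) visited ∷ fresh
      ; cs-ord = AllPairs.tail cs-ord
      ; mid-ord = All.zipWith (λ { (a , as) → a ∷ as }) (AllPairs.head cs-ord , All.tail mid-ord)
      ; rs-ord = All.head mid-ord ∷ rs-ord
      ; room = ℕ.≤-trans (ℕ.≤-reflexive (ℕ.+-suc (length cs) (length rs))) room }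
      where
      open Roots x
      split : ∀ {d} → d L.∈ c ∷ cs ⊎ Visited vis d → d L.∈ cs ⊎ Visited (vis [ toℕ c ≔ 1 ]) d
      split (inj₁ (here refl)) = inj₂ (Visited-new {vis} c)
      split (inj₁ (there d∈))  = inj₁ d∈
      split {d} (inj₂ vd)      = inj₂ (Visited-mono {vis} c {d} vd)

    Roots-finish : ∀ {vis rs} → Roots vis [] rs → Selected rs
    Roots-finish {vis} {rs} x = record
      { Roots x using (rs⊆; fresh; rs-ord; room) ; covers = λ c∈ → cover (Roots.covered x c∈) }
      where
      cover : ∀ {c} → c L.∈ [] ⊎ Visited vis c → ∃[ r ] r L.∈ rs × r ⟶* c
      cover {c} (inj₂ vc) = Roots.reached x c vc

  -- Optimality of the second selection

  Antichain : List (Fin n) → Set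
  Antichain = AllPairs (λ u v → ¬ (u ⟶* v) × ¬ (v ⟶* u))

  antichain-≡ : ∀ {vs u v} → Antichain vs → u L.∈ vs → v L.∈ vs → u ⟶* v → u ≡ v
  antichain-≡ _        (here refl) (here refl) _    = refl
  antichain-≡ (a ∷ _)  (here refl) (there v∈)  path = contradiction path (proj₁ (All.lookup a v∈))
  antichain-≡ (a ∷ _)  (there u∈)  (here refl) path = contradiction path (proj₂ (All.lookup a u∈))
  antichain-≡ (_ ∷ as) (there u∈)  (there v∈)  path = antichain-≡ as u∈ v∈ path

  module _ {A : Subset n} {cs₁ rs₁ rs₂ : List (Fin n)} (cs₁⊆A : ∀ {v} → v L.∈ cs₁ → v ∈ A)
           (A⊆cs₁ : ∀ {v} → v ∈ A → v L.∈ cs₁)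
           (sel₁ : Selected (λ _ _ → ⊤) cs₁ rs₁) (sel₂ : Selected Unreached rs₁ rs₂) where
    private
      module S₁ = Selected sel₁
      module S₂ = Selected sel₂

    covers : ∀ {v} → v ∈ A → ∃[ r ] r L.∈ rs₂ × r ⟶* v
    covers v∈A with S₁.covers (A⊆cs₁ v∈A)
    ... | r , r∈ , r⟶v with S₂.covers r∈
    ... | q , q∈ , q⟶r = q , q∈ , q⟶r ◅◅ r⟶v

    rs₂⊆A : ∀ {v} → v L.∈ rs₂ → v ∈ A
    rs₂⊆A v∈ = cs₁⊆A (All.lookup S₁.rs⊆ (All.lookup S₂.rs⊆ v∈))

    antichain : Antichain rs₂
    antichain = AllPairs.zipWith (λ z → z) (S₂.rs-ord , S₂.fresh)

    length≤∣ZeroCost∣ : ∀ {X} → ZeroCost G A X → length rs₂ ≤ ∣ X ∣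
    length≤∣ZeroCost∣ {X} z = length≤∣X∣ {Rep = _⟶*_} rs₂ X
      (All.tabulate λ r∈ → Z.covers (rs₂⊆A r∈))
      (distinct rs₂ (λ r∈ → r∈) antichain)
      where
      module Z = ZeroCost z
      one : ∀ {u v x} → u L.∈ rs₂ → v L.∈ rs₂ → x ∈ X → x ⟶* u → x ⟶* v → u ≡ v
      one u∈ v∈ x∈ xu xv with covers (Z.within x∈)
      ... | r , r∈ , rx = trans (sym (antichain-≡ antichain r∈ u∈ (rx ◅◅ xu))) (antichain-≡ antichain r∈ v∈ (rx ◅◅ xv))
      distinct : ∀ vs → (∀ {v} → v L.∈ vs → v L.∈ rs₂) → Antichain vs →
                 AllPairs (λ v w → ∀ x → x ∈ X → x ⟶* v → x ⟶* w → Empty.⊥) vs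
      distinct []       _  _ = []
      distinct (v ∷ vs) ⊆₂ (a ∷ as) =
        All.tabulate (λ w∈ x x∈ xv xw → proj₁ (All.lookup a w∈) (subst (v ⟶*_) (one (⊆₂ (here refl)) (⊆₂ (there w∈)) x∈ xv xw) ε))
        ∷ distinct vs (⊆₂ ∘ there) as

    ZeroCost-selected : ClosedUnderEdges G A → ZeroCost G A (fromList rs₂)
    ZeroCost-selected closed = record
      { within = λ v∈ → rs₂⊆A (∈-fromList⁻ rs₂ v∈)
      ; closed = closed
      ; covers = λ v∈A → let r , r∈ , path = covers v∈A in r , ∈-fromList⁺ r∈ , path }

-- The program

-- The memory is divided into arrays; flag is the characteristic vector of A,
-- cand and root hold stacks of candidates and of selected nodes, stack the nodes
-- whose edge lists are not yet exhausted.
data Region : Set where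
  flag source target head vis next cand root stack : Region

index : Region → ℕ
index flag = 0
index source = 1
index target = 2
index head = 3
index vis = 4
index next = 5
index cand = 6
index root = 7
index stack = 8

index-injective : ∀ r r′ → index r ≡ index r′ → r ≡ r′
index-injective flag flag _ = refl
index-injective source source _ = refl
index-injective target target _ = refl
index-injective head head _ = refl
index-injective vis vis _ = refl
index-injective next next _ = refl
index-injective cand cand _ = refl
index-injective root root _ = refl
index-injective stack stack _ = refl

-- The nodes selected in the first round become the candidates of the second by
-- exchanging the base addresses of the two arrays.
swap : Region → Region
swap cand = root
swap root = cand
swap flag = flag
swap source = source
swap target = target
swap head = head
swap vis = vis
swap next = next
swap stack = stack

swap-involutive : ∀ r → swap (swap r) ≡ r
swap-involutive flag = refl
swap-involutive source = refl
swap-involutive target = refl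
swap-involutive head = refl
swap-involutive vis = refl
swap-involutive next = refl
swap-involutive cand = refl
swap-involutive root = refl
swap-involutive stack = refl

Arrays : Set
Arrays = Region → ℕ → ℕ

-- Comparing regions by `index` lets a read from a different literal region compute to the old
-- array, so facts about untouched arrays carry over without proof.
write : Arrays → Region → ℕ → ℕ → Arrays
write arr r i x r′ = if index r′ ≡ᵇ index r then arr r′ [ i ≔ x ] else arr r′

rAns rOne rZero rN rM rB rI rX rY rU rE rH rV rSp rCp rRp rTot rBad : Reg
rAns = 0
rOne = 1
rZero = 2
rN = 3
rM = 4
rB = 5
rI = 20
rX = 21
rY = 22
rU = 23
rE = 24
rH = 25
rV = 26
rSp = 30
rCp = 31
rRp = 32
rTot = 33
rBad = 34

base : Region → Reg
base r = 6 + index r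

-- Registers that never change within a round.  Stating their values as one equation
-- between lists makes it carry over to later states by computation.
constRegs : List Reg
constRegs = 1 ∷ 2 ∷ 3 ∷ 4 ∷ 5 ∷ 6 ∷ 7 ∷ 8 ∷ 9 ∷ 10 ∷ 11 ∷ 12 ∷ 13 ∷ 14 ∷ []

block : List Instr → Program
block = foldr (λ i P → instr i ⨾ P) skip

-- The first three arrays are the input itself: n, m and b fill cells 0 to 2, so `flag` begins at 3.
-- The fresh register `rZero` provides address 0, and rational register 0 keeps the threshold 1 for
-- weights.
setup : Program
setup = block
  ( const rOne 1 ∷ load rN rZero ∷ load rM rOne ∷ add rX rOne rOne ∷ load rB rX
  ∷ add (base flag) rX rOne ∷ add (base source) (base flag) rN ∷ add (base target) (base source) rM
  ∷ add (base head) (base target) rM ∷ add (base vis) (base head) rN ∷ add (base next) (base vis) rN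
  ∷ add (base cand) (base next) rM ∷ add (base root) (base cand) rN ∷ add (base stack) (base root) rN
  ∷ qconst 0 1ℚ ∷ [])

fetch : Reg → Region → Reg → Program
fetch d r i = instr (add d (base r) i) ⨾ instr (load d d)

put : Region → Reg → Reg → Program
put r i z = instr (add rY (base r) i) ⨾ instr (store rY z)

push : Region → Reg → Reg → Program
push r p z = put r p z ⨾ instr (add p p rOne)

-- Truncated subtraction of the two flags gives 1 exactly when the edge leaves A, so `rBad` counts
-- such edges.
checkBody : Program
checkBody = instr (sub rE rI rOne)
  ⨾ fetch rX source rE ⨾ fetch rX flag rX ⨾ fetch rV target rE ⨾ fetch rV flag rV
  ⨾ instr (sub rX rX rV) ⨾ instr (add rBad rBad rX)

-- Free of branches: the node is always written above the top of the stack, and its flag decides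
-- whether the top moves past it.
candBody : Program
candBody = instr (sub rV rI rOne) ⨾ put cand rCp rV ⨾ fetch rX flag rV ⨾ instr (add rCp rCp rX)

clearBody : Program
clearBody = instr (sub rV rI rOne) ⨾ put head rV rZero ⨾ put vis rV rZero

-- As weights are at most 1, testing whether 1 is at most the weight detects weight 1. Inserting at
-- the front makes the lists decreasing.
listBody : Program
listBody = instr (qload 1 rI) ⨾
  ifte (qleq 0 1)
    (instr (sub rE rI rOne) ⨾ fetch rU source rE ⨾ fetch rH head rU ⨾ put next rE rH ⨾ put head rU rI)
    skip

visit : Program
visit = put vis rV rOne ⨾ push stack rSp rV

-- One iteration examines an edge, pops a node or takes a candidate. `rTot` is nonzero as long as
-- either stack is nonempty, so a single test controls the whole round.
searchBody : Program
searchBody =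
  ifte (leq rOne rSp)
    (instr (sub rX rSp rOne) ⨾ fetch rU stack rX ⨾ fetch rH head rU ⨾
     ifte (leq rOne rH)
       (instr (sub rE rH rOne) ⨾ fetch rX next rE ⨾ put head rU rX ⨾ fetch rV target rE ⨾ fetch rX vis rV ⨾
        ifte (leq rOne rX) skip visit)
       (instr (sub rSp rSp rOne)))
    (instr (sub rCp rCp rOne) ⨾ fetch rV cand rCp ⨾ fetch rX vis rV ⨾
     ifte (leq rOne rX) skip (push root rRp rV ⨾ visit))
  ⨾ instr (add rTot rSp rCp)

loop-over : Reg → Program → Program
loop-over bound P = for rI bound rOne P

-- The lists are built anew in each round because the search consumes their heads.
pass : Program
pass = loop-over rN clearBody ⨾ loop-over rM listBody ⨾ instr (add rTot rSp rCp) ⨾ while (leq rOne rTot) searchBody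

-- Candidates are popped from the top, so reusing the stack of selected nodes already yields the
-- reverse order.
exchange : Program
exchange = block
  ( add rX (base cand) rZero ∷ add (base cand) (base root) rZero ∷ add (base root) rX rZero
  ∷ add rCp rRp rZero ∷ const rRp 0 ∷ [])

answer : Program
answer = ifte (leq rBad rZero) (ifte (leq rRp rB) (instr (const rAns 1)) skip) skip

program : Program
program = setup ⨾ loop-over rM checkBody ⨾ loop-over rN candBody ⨾ pass ⨾ exchange ⨾ pass ⨾ answer

-- Correctness and running time on one instance

module Verification (I : Instance) where
  open Instance I
  open InfluenceGraph G

  N : ℕ
  N = 1 + n + m

  open Hoare N (s≤s z≤n)
  open Searching G
  open State

  n≤N : n ≤ N
  n≤N = ℕ.≤-trans (ℕ.m≤m+n n m) (ℕ.n≤1+n _)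

  m≤N : m ≤ N
  m≤N = ℕ.≤-trans (ℕ.m≤n+m m n) (ℕ.n≤1+n _)

  sizes : List ℕ
  sizes = n ∷ m ∷ m ∷ n ∷ n ∷ m ∷ n ∷ n ∷ n ∷ []

  extent : Region → ℕ
  extent r = contents 0 sizes (index r)

  Layout : Set
  Layout = Region → ℕ

  Disjoint : Layout → Set
  Disjoint off = ∀ r r′ {i i′} → i < extent r → i′ < extent r′ → off r + i ≡ off r′ + i′ → r ≡ r′

  start : ℕ → ℕ
  start zero    = 3
  start (suc k) = start k + contents 0 sizes k

  start-mono : ∀ {k k′} → k ≤ k′ → start k ≤ start k′
  start-mono {zero} {zero} z≤n = ℕ.≤-refl
  start-mono {zero} {suc k′} z≤n = ℕ.≤-trans (start-mono {zero} {k′} z≤n) (ℕ.m≤m+n _ _)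
  start-mono {suc k} {suc k′} (s≤s k≤) with ℕ.m≤n⇒m<n∨m≡n k≤
  ... | inj₁ k<   = ℕ.≤-trans (start-mono k<) (ℕ.m≤m+n _ _)
  ... | inj₂ refl = ℕ.≤-refl

  layout : Layout
  layout r = start (index r)

  layout-disjoint : Disjoint layout
  layout-disjoint r r′ {i} {i′} i< i′< eq with ℕ.<-cmp (index r) (index r′)
  ... | tri≈ _ same _ = index-injective r r′ same
  ... | tri< lt _ _ = contradiction eq (ℕ.<⇒≢ (ℕ.<-≤-trans (ℕ.+-monoʳ-< (layout r) i<) (ℕ.≤-trans (start-mono lt) (ℕ.m≤m+n _ i′))))
  ... | tri> _ _ gt = contradiction (sym eq) (ℕ.<⇒≢ (ℕ.<-≤-trans (ℕ.+-monoʳ-< (layout r′) i′<) (ℕ.≤-trans (start-mono gt) (ℕ.m≤m+n _ i))))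

  extent-swap : ∀ r → extent (swap r) ≡ extent r
  extent-swap flag = refl
  extent-swap source = refl
  extent-swap target = refl
  extent-swap head = refl
  extent-swap vis = refl
  extent-swap next = refl
  extent-swap cand = refl
  extent-swap root = refl
  extent-swap stack = refl

  swap-disjoint : ∀ {off} → Disjoint off → Disjoint (off ∘ swap)
  swap-disjoint dis r r′ {i} {i′} i< i′< eq =
    trans (sym (swap-involutive r)) (trans (cong swap
      (dis (swap r) (swap r′) (subst (i <_) (sym (extent-swap r)) i<) (subst (i′ <_) (sym (extent-swap r′)) i′<) eq))
      (swap-involutive r′))

  record Represents (off : Layout) (M : ℕ → ℕ) (arr : Arrays) : Set where
    constructor represents
    field at : ∀ r {i} → i < extent r → M (off r + i) ≡ arr r i

  open Represents

  -- A write inside its own array cannot disturb another one. The `room` fields of the search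
  -- invariants supply `i < extent r` for the stacks.
  represents-write : ∀ {off M arr r i a z z′} → Disjoint off → Represents off M arr → i < extent r →
                     a ≡ off r + i → z ≡ z′ → Represents off (M [ a ≔ z ]) (write arr r i z′)
  represents-write {off} {M} {arr} {r} {i} {z = z} dis rep i< refl refl = represents go
    where
    go : ∀ r′ {i′} → i′ < extent r′ → (M [ off r + i ≔ z ]) (off r′ + i′) ≡ write arr r i z r′ i′
    go r′ {i′} i′< with index r′ ≡ᵇ index r in test
    ... | false = trans (≔-other M λ eq → subst T test (ℕ.≡⇒≡ᵇ _ _ (cong index (dis r′ r i′< i< eq)))) (at rep r′ i′<)
    ... | true with index-injective r′ r (ℕ.≡ᵇ⇒≡ _ _ (subst T (sym test) tt))
    ...   | refl with i′ ℕ.≟ i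
    ...     | yes refl = trans (≔-same M (off r + i)) (sym (≔-same (arr r) i))
    ...     | no i′≢i  = trans (≔-other M (i′≢i ∘ ℕ.+-cancelˡ-≡ (off r) i′ i)) (trans (at rep r′ i′<) (sym (≔-other (arr r) i′≢i)))

  bit : Fin n → ℕ
  bit v = if does (v ∈? A) then 1 else 0

  constVals : Layout → List ℕ
  constVals off = 1 ∷ 0 ∷ n ∷ m ∷ b ∷ off flag ∷ off source ∷ off target ∷ off head ∷ off vis ∷ off next
    ∷ off cand ∷ off root ∷ off stack ∷ []

  record Base (off : Layout) (arr : Arrays) (σ : State) : Set where
    field
      consts   : List.map (reg σ) constRegs ≡ constVals off
      disjoint : Disjoint off
      rep      : Represents off (mem σ) arr
      flags    : ∀ v → arr flag (toℕ v) ≡ bit v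
      sources  : ∀ e → arr source (toℕ e) ≡ toℕ (src e)
      targets  : ∀ e → arr target (toℕ e) ≡ toℕ (tgt e)
      weights  : ∀ e → qmem σ (suc (toℕ e)) ≡ weight e
      unit     : qreg σ 0 ≡ 1ℚ
      ans      : reg σ rAns ≡ 0

    constant : ∀ k → contents 0 (List.map (reg σ) constRegs) k ≡ contents 0 (constVals off) k
    constant k = cong (λ xs → contents 0 xs k) consts

    read : ∀ r {a i z} → a ≡ off r + i → i < extent r → arr r i ≡ z → mem σ a ≡ z
    read r refl i< eq = trans (at rep r i<) eq

  Good : Fin m → Set
  Good e = src e ∈ A → tgt e ∈ A

  good-bit : ∀ e → bit (src e) ∸ bit (tgt e) ≡ 0 ⇔ Good e
  good-bit e with src e ∈? A | tgt e ∈? A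
  ... | yes s | yes t = mk⇔ (λ _ _ → t) (λ _ → refl)
  ... | yes s | no t  = mk⇔ (λ ()) (λ g → contradiction (g s) t)
  ... | no s  | yes t = mk⇔ (λ _ _ → t) (λ _ → refl)
  ... | no s  | no t  = mk⇔ (λ _ s′ → contradiction s′ s) (λ _ → refl)

  record Checking (j : ℕ) (σ : State) : Set where
    field
      arr  : Arrays
      bs   : Base layout arr σ
      i≡   : reg σ rI ≡ suc j
      bad⇔ : reg σ rBad ≡ 0 ⇔ (∀ e → toℕ e < j → Good e)
      cp≡0 : reg σ rCp ≡ 0
      rp≡0 : reg σ rRp ≡ 0
      sp≡0 : reg σ rSp ≡ 0

  check-step : ∀ {σ} (η : Fin m) → Checking (toℕ η) σ →
               wp checkBody (λ τ → Checking (suc (toℕ η)) (exec (add rI rI rOne) τ)) σ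
  check-step {σ} η c = record
    { arr = arr ; bs = record { Base bs } ; i≡ = trans (cong₂ _+_ i≡ (constant 0)) (ℕ.+-comm _ 1)
    ; bad⇔ = subst (λ z → z ≡ 0 ⇔ (∀ e → toℕ e < suc (toℕ η) → Good e)) (cong (reg σ rBad +_) (sym test≡)) new
    ; cp≡0 = cp≡0 ; rp≡0 = rp≡0 ; sp≡0 = sp≡0 }
    where
    open Checking c
    open Base bs
    e≡ : reg σ rI ∸ reg σ rOne ≡ toℕ η
    e≡ = cong₂ _∸_ i≡ (constant 0)
    src≡ : mem σ (reg σ (base source) + (reg σ rI ∸ reg σ rOne)) ≡ toℕ (src η)
    src≡ = read source (cong₂ _+_ (constant 6) e≡) (Fin.toℕ<n η) (sources η)
    tgt≡ : mem σ (reg σ (base target) + (reg σ rI ∸ reg σ rOne)) ≡ toℕ (tgt η)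
    tgt≡ = read target (cong₂ _+_ (constant 7) e≡) (Fin.toℕ<n η) (targets η)
    test≡ : _ ≡ bit (src η) ∸ bit (tgt η)
    test≡ = cong₂ _∸_ (read flag (cong₂ _+_ (constant 5) src≡) (Fin.toℕ<n (src η)) (flags (src η)))
                      (read flag (cong₂ _+_ (constant 5) tgt≡) (Fin.toℕ<n (tgt η)) (flags (tgt η)))
    new : reg σ rBad + (bit (src η) ∸ bit (tgt η)) ≡ 0 ⇔ (∀ e → toℕ e < suc (toℕ η) → Good e)
    new = mk⇔
      (λ eq d d< → [ (λ d<η → Equivalence.to bad⇔ (ℕ.m+n≡0⇒m≡0 _ eq) d d<η)
                   , (λ d≡η → subst Good (sym (Fin.toℕ-injective d≡η)) (Equivalence.to (good-bit η) (ℕ.m+n≡0⇒n≡0 (reg σ rBad) eq))) ]′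
                   (ℕ.m≤n⇒m<n∨m≡n (ℕ.≤-pred d<)))
      (λ good → cong₂ _+_ (Equivalence.from bad⇔ (λ d d< → good d (ℕ.m≤n⇒m≤1+n d<)))
                          (Equivalence.from (good-bit η) (good η ℕ.≤-refl)))

  test-true : ∀ {a b a′ b′} → a ≡ a′ → b ≡ b′ → (a ℕ.≤ᵇ b) ≡ true → a′ ≤ b′
  test-true {a} {b} refl refl test = ℕ.≤ᵇ⇒≤ a b (subst T (sym test) tt)

  test-false : ∀ {a b a′ b′} → a ≡ a′ → b ≡ b′ → (a ℕ.≤ᵇ b) ≡ false → ¬ a′ ≤ b′
  test-false refl refl test a≤b = subst T test (ℕ.≤⇒≤ᵇ a≤b)

  -- The head of the list is the top of the stack; cells are numbered from the bottom, so a push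
  -- moves nothing.
  Stacked : (ℕ → ℕ) → List (Fin n) → Set
  Stacked f []       = ⊤
  Stacked f (v ∷ vs) = f (length vs) ≡ toℕ v × Stacked f vs

  Stacked-above : ∀ {f k z} vs → length vs ≤ k → Stacked f vs → Stacked (f [ k ≔ z ]) vs
  Stacked-above []       _    _         = tt
  Stacked-above {f} (v ∷ vs) len< (eq , s) =
    trans (≔-other f (ℕ.<⇒≢ len<)) eq , Stacked-above vs (ℕ.<⇒≤ len<) s

  Stacked-push : ∀ {f v} vs → Stacked f vs → Stacked (f [ length vs ≔ toℕ v ]) (v ∷ vs)
  Stacked-push {f} vs s = ≔-same f (length vs) , Stacked-above vs ℕ.≤-refl s

  Verdict : State → Set
  Verdict σ = reg σ rBad ≡ 0 ⇔ ClosedUnderEdges G A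

  record Ready (off : Layout) (cs : List (Fin n)) (arr : Arrays) (σ : State) : Set where
    field
      bs      : Base off arr σ
      verdict : Verdict σ
      cands   : Stacked (arr cand) cs
      room    : length cs ≤ n
      cp≡     : reg σ rCp ≡ length cs
      rp≡     : reg σ rRp ≡ 0
      sp≡     : reg σ rSp ≡ 0

  -- Composing with the initialisation of the counter turns the loop invariant itself into the
  -- assertion before the loop.
  check : Triple (Checking 0 ∘ exec (const rI 1)) (loop-over rM checkBody) (cost-for checkBody)
            (λ σ → ∃[ arr ] Ready layout [] arr σ)
  check = for-loop Checking m m≤N
    (λ c → Checking.i≡ c , Base.constant (Checking.bs c) 3)
    (λ c → c)
    check-step
    (λ c → let open Checking c in arr , record
      { bs = bs
      ; verdict = mk⇔ (λ eq e → Equivalence.to bad⇔ eq e (Fin.toℕ<n e)) (λ closed → Equivalence.from bad⇔ (λ e _ → closed e))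
      ; cands = tt ; room = z≤n ; cp≡ = cp≡0 ; rp≡ = rp≡0 ; sp≡ = sp≡0 })

  record Collecting (j : ℕ) (σ : State) : Set where
    field
      cs       : List (Fin n)
      arr      : Arrays
      ready    : Ready layout cs arr σ
      i≡       : reg σ rI ≡ suc j
      len      : length cs ≤ j
      sound    : ∀ {v} → v L.∈ cs → v ∈ A
      complete : ∀ {v} → toℕ v < j → v ∈ A → v L.∈ cs

  bit-yes : ∀ {v} → v ∈ A → bit v ≡ 1
  bit-yes {v} v∈ with v ∈? A
  ... | yes _ = refl
  ... | no v∉ = contradiction v∈ v∉

  bit-no : ∀ {v} → v ∉ A → bit v ≡ 0
  bit-no {v} v∉ with v ∈? A
  ... | yes v∈ = contradiction v∈ v∉
  ... | no _   = refl

  collect-step : ∀ {σ} (ν : Fin n) → Collecting (toℕ ν) σ →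
                 wp candBody (λ τ → Collecting (suc (toℕ ν)) (exec (add rI rI rOne) τ)) σ
  collect-step {σ} ν c = finish (ν ∈? A)
    where
    open Collecting c
    open Ready ready
    open Base bs
    v≡ : reg σ rI ∸ reg σ rOne ≡ toℕ ν
    v≡ = cong₂ _∸_ i≡ (constant 0)
    arr′ : Arrays
    arr′ = write arr cand (length cs) (toℕ ν)
    mem′ : ℕ → ℕ
    mem′ = mem σ [ reg σ (base cand) + reg σ rCp ≔ reg σ rI ∸ reg σ rOne ]
    rep′ : Represents layout mem′ arr′
    rep′ = represents-write {r = cand} disjoint rep (ℕ.≤-<-trans len (Fin.toℕ<n ν)) (cong₂ _+_ (constant 11) cp≡) v≡
    flag≡ : mem′ (reg σ (base flag) + (reg σ rI ∸ reg σ rOne)) ≡ bit ν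
    flag≡ = trans (cong mem′ (cong₂ _+_ (constant 5) v≡)) (trans (at rep′ flag (Fin.toℕ<n ν)) (flags ν))
    i≡′ : reg σ rI + reg σ rOne ≡ suc (suc (toℕ ν))
    i≡′ = trans (cong₂ _+_ i≡ (constant 0)) (ℕ.+-comm _ 1)
    finish : Dec (ν ∈ A) → wp candBody (λ τ → Collecting (suc (toℕ ν)) (exec (add rI rI rOne) τ)) σ
    finish (yes ν∈) = record
      { cs = ν ∷ cs ; arr = arr′
      ; ready = record
        { bs = record { Base bs hiding (rep) ; rep = rep′ } ; verdict = verdict
        ; cands = Stacked-push cs cands
        ; room = ℕ.≤-trans (s≤s len) (Fin.toℕ<n ν)
        ; cp≡ = trans (cong₂ _+_ cp≡ (trans flag≡ (bit-yes ν∈))) (ℕ.+-comm _ 1)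
        ; rp≡ = rp≡ ; sp≡ = sp≡ }
      ; i≡ = i≡′
      ; len = s≤s len
      ; sound = λ { (here refl) → ν∈ ; (there v∈) → sound v∈ }
      ; complete = λ v< v∈ → [ (λ v<ν → there (complete v<ν v∈)) , (λ v≡ν → here (Fin.toℕ-injective v≡ν)) ]′
                               (ℕ.m≤n⇒m<n∨m≡n (ℕ.≤-pred v<)) }
    finish (no ν∉) = record
      { cs = cs ; arr = arr′
      ; ready = record
        { bs = record { Base bs hiding (rep) ; rep = rep′ } ; verdict = verdict
        ; cands = Stacked-above cs ℕ.≤-refl cands
        ; room = room
        ; cp≡ = trans (cong₂ _+_ cp≡ (trans flag≡ (bit-no ν∉))) (ℕ.+-identityʳ _)
        ; rp≡ = rp≡ ; sp≡ = sp≡ }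
      ; i≡ = i≡′
      ; len = ℕ.m≤n⇒m≤1+n len
      ; sound = sound
      ; complete = λ v< v∈ → [ (λ v<ν → complete v<ν v∈)
                             , (λ v≡ν → contradiction (subst (_∈ A) (Fin.toℕ-injective v≡ν) v∈) ν∉) ]′
                               (ℕ.m≤n⇒m<n∨m≡n (ℕ.≤-pred v<)) }

  record Collected (cs : List (Fin n)) : Set where
    field
      sound    : ∀ {v} → v L.∈ cs → v ∈ A
      complete : ∀ {v} → v ∈ A → v L.∈ cs

  collect : Triple (λ σ → ∃[ arr ] Ready layout [] arr σ) (loop-over rN candBody) (cost-for candBody)
              (λ σ → ∃[ cs ] Collected cs × ∃[ arr ] Ready layout cs arr σ)
  collect = for-loop Collecting n n≤N
    (λ c → Collecting.i≡ c , Base.constant (Ready.bs (Collecting.ready c)) 2)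
    (λ { (arr , ready) → record
      { cs = [] ; arr = arr ; ready = record { Ready ready hiding (bs) ; bs = record { Base (Ready.bs ready) } }
      ; i≡ = refl ; len = z≤n ; sound = λ () ; complete = λ () } })
    collect-step
    (λ c → let open Collecting c in
      cs , record { sound = sound ; complete = λ {v} → complete (Fin.toℕ<n v) } , arr , ready)

  module _ (off : Layout) (cs₀ : List (Fin n)) where

    record Clearing (j : ℕ) (σ : State) : Set where
      field
        arr   : Arrays
        ready : Ready off cs₀ arr σ
        i≡    : reg σ rI ≡ suc j
        head0 : ∀ v → toℕ {n} v < j → arr head (toℕ v) ≡ 0
        vis0  : ∀ v → toℕ {n} v < j → arr vis (toℕ v) ≡ 0

    clear-step : ∀ {σ} (ν : Fin n) → Clearing (toℕ ν) σ →
                 wp clearBody (λ τ → Clearing (suc (toℕ ν)) (exec (add rI rI rOne) τ)) σ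
    clear-step {σ} ν c = record
      { arr = write (write arr head (toℕ ν) 0) vis (toℕ ν) 0
      ; ready = record
        { Ready ready hiding (bs)
        ; bs = record
          { Base bs hiding (rep)
          ; rep = represents-write disjoint
                    (represents-write disjoint rep (Fin.toℕ<n ν) (cong₂ _+_ (constant 8) v≡) (constant 1))
                    (Fin.toℕ<n ν) (cong₂ _+_ (constant 9) v≡) (constant 1) } }
      ; i≡ = trans (cong₂ _+_ i≡ (constant 0)) (ℕ.+-comm _ 1)
      ; head0 = zeroed {arr head} head0
      ; vis0 = zeroed {arr vis} vis0 }
      where
      open Clearing c
      open Ready ready
      open Base bs
      v≡ : reg σ rI ∸ reg σ rOne ≡ toℕ ν
      v≡ = cong₂ _∸_ i≡ (constant 0)
      zeroed : ∀ {f} → (∀ v → toℕ {n} v < toℕ ν → f (toℕ v) ≡ 0) →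
               ∀ v → toℕ {n} v < suc (toℕ ν) → (f [ toℕ ν ≔ 0 ]) (toℕ v) ≡ 0
      zeroed {f} f0 v v< = ≔-elim (_≡ 0) f ν v (λ _ → refl)
        (λ v≢ν → f0 v (ℕ.≤∧≢⇒< (ℕ.≤-pred v<) (v≢ν ∘ Fin.toℕ-injective)))

    record Linking (j : ℕ) (σ : State) : Set where
      field
        arr   : Arrays
        ready : Ready off cs₀ arr σ
        i≡    : reg σ rI ≡ suc j
        vis0  : ∀ v → arr vis (toℕ {n} v) ≡ 0
        lists : Lists j (arr head) (arr next)

    clear : Triple (λ σ → ∃[ arr ] Ready off cs₀ arr σ) (loop-over rN clearBody) (cost-for clearBody)
              (Linking 0 ∘ exec (const rI 1))
    clear = for-loop Clearing n n≤N
      (λ c → Clearing.i≡ c , Base.constant (Ready.bs (Clearing.ready c)) 2)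
      (λ { (arr , ready) → record
        { arr = arr ; ready = record { Ready ready hiding (bs) ; bs = record { Base (Ready.bs ready) } }
        ; i≡ = refl ; head0 = λ _ () ; vis0 = λ _ () } })
      clear-step
      (λ c → let open Clearing c in record
        { arr = arr ; ready = record { Ready ready hiding (bs) ; bs = record { Base (Ready.bs ready) } }
        ; i≡ = refl ; vis0 = λ v → vis0 v (Fin.toℕ<n v) ; lists = Lists-empty (λ v → head0 v (Fin.toℕ<n v)) })

    link-step : ∀ {σ} (η : Fin m) → Linking (toℕ η) σ →
                wp listBody (λ τ → Linking (suc (toℕ η)) (exec (add rI rI rOne) τ)) σ
    link-step {σ} η c = sure , unsure
      where
      open Linking c
      open Ready ready
      open Base bs
      w≡ : qmem σ (reg σ rI) ≡ weight η
      w≡ = trans (cong (qmem σ) i≡) (weights η)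
      i≡′ : reg σ rI + reg σ rOne ≡ suc (suc (toℕ η))
      i≡′ = trans (cong₂ _+_ i≡ (constant 0)) (ℕ.+-comm _ 1)
      e≡ : reg σ rI ∸ reg σ rOne ≡ toℕ η
      e≡ = cong₂ _∸_ i≡ (constant 0)
      src≡ : mem σ (reg σ (base source) + (reg σ rI ∸ reg σ rOne)) ≡ toℕ (src η)
      src≡ = read source (cong₂ _+_ (constant 6) e≡) (Fin.toℕ<n η) (sources η)
      sure : (qreg σ 0 ℚ.≤ᵇ qmem σ (reg σ rI)) ≡ true → _
      sure test = record
        { arr = write (write arr next (toℕ η) (arr head (toℕ (src η)))) head (toℕ (src η)) (suc (toℕ η))
        ; ready = record
          { Ready ready hiding (bs)
          ; bs = record
            { Base bs hiding (rep)
            ; rep = represents-write disjoint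
                      (represents-write disjoint rep (Fin.toℕ<n η) (cong₂ _+_ (constant 10) e≡)
                        (read head (cong₂ _+_ (constant 8) src≡) (Fin.toℕ<n (src η)) refl))
                      (Fin.toℕ<n (src η)) (cong₂ _+_ (constant 8) src≡) i≡ } }
        ; i≡ = i≡′
        ; vis0 = vis0
        ; lists = Lists-cons η (ℚ.≤-antisym (weight≤1 η)
            (subst₂ ℚ._≤_ unit w≡ (ℚ.≤ᵇ⇒≤ (subst T (sym test) tt)))) lists }
      unsure : (qreg σ 0 ℚ.≤ᵇ qmem σ (reg σ rI)) ≡ false → _
      unsure test = record
        { arr = arr
        ; ready = record { Ready ready hiding (bs) ; bs = record { Base bs } }
        ; i≡ = i≡′
        ; vis0 = vis0
        ; lists = Lists-skip η (λ w≡1 → subst T test (ℚ.≤⇒≤ᵇ (ℚ.≤-reflexive (trans unit (sym (trans w≡ w≡1)))))) lists }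

    record Linked (σ : State) : Set where
      field
        arr   : Arrays
        ready : Ready off cs₀ arr σ
        vis0  : ∀ v → arr vis (toℕ {n} v) ≡ 0
        lists : Lists m (arr head) (arr next)

    link : Triple (Linking 0 ∘ exec (const rI 1)) (loop-over rM listBody) (cost-for listBody) Linked
    link = for-loop Linking m m≤N
      (λ c → Linking.i≡ c , Base.constant (Ready.bs (Linking.ready c)) 3)
      (λ c → c)
      link-step
      (λ c → record { Linking c })

    module _ (R : Fin n → Fin n → Set) where

      -- Examining an edge lowers the first summand, popping the third, taking a candidate the last.
      -- A push raises the third by one but always comes with a newly visited node and either an
      -- examined edge or a taken candidate, so the sum still drops. Initially it is at most m + n +
      -- 0 + n, hence at most `2 * N`.
      potential : Arrays → (st cs : List (Fin n)) → ℕ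
      potential arr st cs = (∣ pending (arr head) ∣ + ∣ unvisited (arr vis) ∣) + (length st + length cs)

      record Exploring (k : ℕ) (σ : State) : Set where
        field
          arr      : Arrays
          cs rs st : List (Fin n)
          bs       : Base off arr σ
          verdict  : Verdict σ
          explore  : Explore (arr head) (arr vis) (arr next) st
          roots    : Roots R cs₀ (arr vis) cs rs
          on-stack : All (Visited (arr vis)) st
          cands    : Stacked (arr cand) cs
          chosen   : Stacked (arr root) rs
          stacked  : Stacked (arr stack) st
          cp≡      : reg σ rCp ≡ length cs
          rp≡      : reg σ rRp ≡ length rs
          sp≡      : reg σ rSp ≡ length st
          tot≡     : reg σ rTot ≡ reg σ rSp + reg σ rCp
          pot≡     : potential arr st cs ≡ k

      Progress : ℕ → State → Set
      Progress k σ = ∃[ j ] j < k × Exploring j (exec (add rTot rSp rCp) σ)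

      consumed : ∀ {P P′ U} S C → P′ < P → (P′ + U) + (S + C) < (P + U) + (S + C)
      consumed {U = U} S C P′<P = ℕ.+-monoˡ-< (S + C) (ℕ.+-monoˡ-< U P′<P)

      discovered : ∀ {P P′ U U′} S C → P′ < P → U′ < U → (P′ + U′) + (suc S + C) < (P + U) + (S + C)
      discovered {P} {P′} {U} {U′} S C P′<P U′<U = subst (_≤ (P + U) + (S + C)) rearrange (ℕ.+-monoˡ-≤ (S + C) (ℕ.+-mono-≤ P′<P U′<U))
        where
        rearrange : suc P′ + suc U′ + (S + C) ≡ suc ((P′ + U′) + (suc S + C))
        rearrange = cong suc (trans (cong (_+ (S + C)) (ℕ.+-suc P′ U′)) (sym (ℕ.+-suc (P′ + U′) (S + C))))

      popped : ∀ PU S C → PU + (S + C) < PU + (suc S + C)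
      popped PU S C = ℕ.+-monoʳ-< PU ℕ.≤-refl

      rejected : ∀ PU C → PU + (0 + C) < PU + (0 + suc C)
      rejected PU C = ℕ.+-monoʳ-< PU ℕ.≤-refl

      accepted : ∀ {P U U′} C → U′ < U → (P + U′) + (1 + C) < (P + U) + (0 + suc C)
      accepted {P} C U′<U = ℕ.+-monoˡ-< (suc C) (ℕ.+-monoʳ-< P U′<U)

      node-step : ∀ {k σ} → Exploring k σ → eval (leq rOne rSp) σ ≡ true →
        wp (instr (sub rX rSp rOne) ⨾ fetch rU stack rX ⨾ fetch rH head rU ⨾
            ifte (leq rOne rH)
              (instr (sub rE rH rOne) ⨾ fetch rX next rE ⨾ put head rU rX ⨾ fetch rV target rE ⨾ fetch rX vis rV ⨾
                ifte (leq rOne rX) skip visit)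
              (instr (sub rSp rSp rOne))) (Progress k) σ
      node-step {σ = σ} x@record { st = [] } test =
        contradiction (test-true (Base.constant (Exploring.bs x) 0) (Exploring.sp≡ x) test) λ ()
      node-step {σ = σ} x@record { arr = arr ; cs = cs ; rs = rs ; st = w ∷ st ; pot≡ = refl } _ = nonempty , empty
        where
        open Exploring x using (bs; verdict; explore; roots; on-stack; cands; chosen; stacked; cp≡; rp≡; sp≡)
        open Base bs
        u≡ : mem σ (reg σ (base stack) + (reg σ rSp ∸ reg σ rOne)) ≡ toℕ w
        u≡ = read stack (cong₂ _+_ (constant 13) (cong₂ _∸_ sp≡ (constant 0)))
               (ℕ.≤-trans (ℕ.m≤n+m (suc (length st)) _) (Explore.room explore)) (proj₁ stacked)
        h≡ : mem σ (reg σ (base head) + mem σ (reg σ (base stack) + (reg σ rSp ∸ reg σ rOne))) ≡ arr head (toℕ w)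
        h≡ = read head (cong₂ _+_ (constant 8) u≡) (Fin.toℕ<n w) refl
        nonempty : (reg σ rOne ℕ.≤ᵇ _) ≡ true → _
        nonempty test with Explore.pointer explore w
        ... | inj₁ h≡0 = contradiction (test-true (constant 0) (trans h≡ h≡0) test) λ ()
        ... | inj₂ (η , h≡η , sure , refl) = old , new
          where
          e≡ : mem σ (reg σ (base head) + mem σ (reg σ (base stack) + (reg σ rSp ∸ reg σ rOne))) ∸ reg σ rOne ≡ toℕ η
          e≡ = cong₂ _∸_ (trans h≡ h≡η) (constant 0)
          arr₁ : Arrays
          arr₁ = write arr head (toℕ (src η)) (arr next (toℕ η))
          mem₁ : ℕ → ℕ
          mem₁ = _
          rep₁ : Represents off mem₁ arr₁
          rep₁ = represents-write disjoint rep (Fin.toℕ<n (src η)) (cong₂ _+_ (constant 8) u≡)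
                   (read next (cong₂ _+_ (constant 10) e≡) (Fin.toℕ<n η) refl)
          v≡ : mem₁ (reg σ (base target) + _) ≡ toℕ (tgt η)
          v≡ = trans (cong mem₁ (cong₂ _+_ (constant 7) e≡)) (trans (at rep₁ target (Fin.toℕ<n η)) (targets η))
          vis≡ : mem₁ (reg σ (base vis) + mem₁ (reg σ (base target) + _)) ≡ arr vis (toℕ (tgt η))
          vis≡ = trans (cong mem₁ (cong₂ _+_ (constant 9) v≡)) (at rep₁ vis (Fin.toℕ<n (tgt η)))
          fewer : ∣ pending (arr₁ head) ∣ < ∣ pending (arr head) ∣
          fewer = pending-decreases explore sure h≡η
          old : (reg σ rOne ℕ.≤ᵇ _) ≡ true → _
          old test = _ , consumed (suc (length st)) (length cs) fewer , record
            { arr = arr₁ ; cs = cs ; rs = rs ; st = src η ∷ st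
            ; bs = record { Base bs hiding (rep) ; rep = rep₁ }
            ; verdict = verdict
            ; explore = Explore-consume explore sure h≡η (test-true (constant 0) vis≡ test) (here refl)
            ; roots = roots ; on-stack = on-stack ; cands = cands ; chosen = chosen ; stacked = stacked
            ; cp≡ = cp≡ ; rp≡ = rp≡ ; sp≡ = sp≡ ; tot≡ = refl ; pot≡ = refl }
          new : (reg σ rOne ℕ.≤ᵇ _) ≡ false → _
          new test = _ , discovered (suc (length st)) (length cs) fewer (unvisited-decreases {arr vis} {tgt η} fresh) , record
            { arr = write (write arr₁ vis (toℕ (tgt η)) 1) stack (suc (length st)) (toℕ (tgt η))
            ; cs = cs ; rs = rs ; st = tgt η ∷ src η ∷ st
            ; bs = record
              { Base bs hiding (rep)
              ; rep = represents-write disjoint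
                        (represents-write disjoint rep₁ (Fin.toℕ<n (tgt η)) (cong₂ _+_ (constant 9) v≡) (constant 0))
                        (Explore-room explore fresh) (cong₂ _+_ (constant 13) sp≡) v≡ }
            ; verdict = verdict
            -- The program advances `head` before marking the target. The invariant takes these
            -- steps in the opposite order, since consuming an edge requires its target to be
            -- visited; the writes concern different arrays, so the results agree by computation.
            ; explore = Explore-consume (Explore-visit explore fresh) sure h≡η (Visited-new {arr vis} (tgt η)) (there (here refl))
            ; roots = let r , r∈ , path = Roots.reached roots (src η) (All.head on-stack) in
                Roots-visit R cs₀ roots r∈ (path ◅◅ edge sure)
            ; on-stack = Visited-new {arr vis} (tgt η) ∷ All.map (λ {z} → Visited-mono {arr vis} (tgt η) {z}) on-stack
            ; cands = cands ; chosen = chosen ; stacked = Stacked-push (src η ∷ st) stacked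
            ; cp≡ = cp≡ ; rp≡ = rp≡
            ; sp≡ = trans (cong₂ _+_ sp≡ (constant 0)) (ℕ.+-comm _ 1)
            ; tot≡ = refl ; pot≡ = refl }
            where
            fresh : ¬ Visited (arr vis) (tgt η)
            fresh = test-false (constant 0) vis≡ test
        empty : (reg σ rOne ℕ.≤ᵇ _) ≡ false → _
        empty test = _ , popped _ (length st) (length cs) , record
          { arr = arr ; cs = cs ; rs = rs ; st = st
          ; bs = record { Base bs }
          ; verdict = verdict
          ; explore = Explore-pop explore (ℕ.n<1⇒n≡0 (ℕ.≰⇒> (test-false (constant 0) h≡ test)))
          ; roots = roots ; on-stack = All.tail on-stack ; cands = cands ; chosen = chosen ; stacked = proj₂ stacked
          ; cp≡ = cp≡ ; rp≡ = rp≡ ; sp≡ = cong₂ _∸_ sp≡ (constant 0) ; tot≡ = refl ; pot≡ = refl }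

      cand-step : ∀ {k σ} → Exploring k σ → eval (leq rOne rTot) σ ≡ true → eval (leq rOne rSp) σ ≡ false →
        wp (instr (sub rCp rCp rOne) ⨾ fetch rV cand rCp ⨾ fetch rX vis rV ⨾
            ifte (leq rOne rX) skip (push root rRp rV ⨾ visit)) (Progress k) σ
      cand-step {σ = σ} x@record { st = w ∷ st } _ test =
        contradiction (s≤s z≤n) (test-false (Base.constant (Exploring.bs x) 0) (Exploring.sp≡ x) test)
      cand-step {σ = σ} x@record { st = [] ; cs = [] } test _ =
        contradiction (test-true (Base.constant (Exploring.bs x) 0)
          (trans (Exploring.tot≡ x) (cong₂ _+_ (Exploring.sp≡ x) (Exploring.cp≡ x))) test) λ ()
      cand-step {σ = σ} x@record { arr = arr ; cs = c ∷ cs ; rs = rs ; st = [] ; pot≡ = refl } _ _ = old , new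
        where
        open Exploring x using (bs; verdict; explore; roots; cands; chosen; cp≡; rp≡; sp≡)
        open Base bs
        cp′≡ : reg σ rCp ∸ reg σ rOne ≡ length cs
        cp′≡ = cong₂ _∸_ cp≡ (constant 0)
        room : suc (length cs + length rs) ≤ n
        room = Roots.room roots
        v≡ : mem σ (reg σ (base cand) + (reg σ rCp ∸ reg σ rOne)) ≡ toℕ c
        v≡ = read cand (cong₂ _+_ (constant 11) cp′≡) (ℕ.≤-trans (s≤s (ℕ.m≤m+n _ _)) room) (proj₁ cands)
        vis≡ : mem σ (reg σ (base vis) + mem σ (reg σ (base cand) + (reg σ rCp ∸ reg σ rOne))) ≡ arr vis (toℕ c)
        vis≡ = read vis (cong₂ _+_ (constant 9) v≡) (Fin.toℕ<n c) refl
        old : (reg σ rOne ℕ.≤ᵇ _) ≡ true → _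
        old test = _ , rejected _ (length cs) , record
          { arr = arr ; cs = cs ; rs = rs ; st = []
          ; bs = record { Base bs }
          ; verdict = verdict
          ; explore = explore
          ; roots = Roots-drop R cs₀ roots (test-true (constant 0) vis≡ test)
          ; on-stack = [] ; cands = proj₂ cands ; chosen = chosen ; stacked = tt
          ; cp≡ = cp′≡ ; rp≡ = rp≡ ; sp≡ = sp≡ ; tot≡ = refl ; pot≡ = refl }
        new : (reg σ rOne ℕ.≤ᵇ _) ≡ false → _
        new test = _ , accepted (length cs) (unvisited-decreases {arr vis} {c} fresh) , record
          { arr = write (write (write arr root (length rs) (toℕ c)) vis (toℕ c) 1) stack 0 (toℕ c)
          ; cs = cs ; rs = c ∷ rs ; st = c ∷ []
          ; bs = record
            { Base bs hiding (rep)
            ; rep = represents-write disjoint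
                      (represents-write disjoint
                        (represents-write disjoint rep
                          (ℕ.≤-trans (s≤s (ℕ.m≤n+m _ _)) room) (cong₂ _+_ (constant 12) rp≡) v≡)
                        (Fin.toℕ<n c) (cong₂ _+_ (constant 9) v≡) (constant 0))
                      (Explore-room explore fresh) (cong₂ _+_ (constant 13) sp≡) v≡ }
          ; verdict = verdict
          ; explore = Explore-visit explore fresh
          ; roots = Roots-new R cs₀ roots explore fresh
          ; on-stack = Visited-new {arr vis} c ∷ [] ; cands = proj₂ cands
          ; chosen = Stacked-push rs chosen ; stacked = Stacked-push {arr stack} [] tt
          ; cp≡ = cp′≡
          ; rp≡ = trans (cong₂ _+_ rp≡ (constant 0)) (ℕ.+-comm _ 1)
          ; sp≡ = cong₂ _+_ sp≡ (constant 0)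
          ; tot≡ = refl ; pot≡ = refl }
          where
          fresh : ¬ Visited (arr vis) c
          fresh = test-false (constant 0) vis≡ test

      record Finished (σ : State) : Set where
        field
          arr      : Arrays
          rs       : List (Fin n)
          bs       : Base off arr σ
          verdict  : Verdict σ
          selected : Selected R cs₀ rs
          chosen   : Stacked (arr root) rs
          rp≡      : reg σ rRp ≡ length rs
          sp≡      : reg σ rSp ≡ 0

      Started : State → Set
      Started σ = ∃[ k ] k ≤ 2 * N × Exploring k σ

      enter : ∀ {σ} → AllPairs R cs₀ → Linked σ → Started (exec (add rTot rSp rCp) σ)
      enter {σ} ord l = _ , bounded , record
        { arr = arr ; cs = cs₀ ; rs = [] ; st = []
        ; bs = record { Base bs } ; verdict = verdict
        ; explore = Explore-start lists vis0
        ; roots = Roots-start R cs₀ vis0 ord room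
        ; on-stack = [] ; cands = cands ; chosen = tt ; stacked = tt
        ; cp≡ = cp≡ ; rp≡ = rp≡ ; sp≡ = sp≡ ; tot≡ = refl ; pot≡ = refl }
        where
        open Linked l
        open Ready ready
        bounded : potential arr [] cs₀ ≤ 2 * N
        bounded = ℕ.+-mono-≤
          (ℕ.≤-trans (ℕ.+-mono-≤ (∣p∣≤n (pending (arr head))) (∣p∣≤n (unvisited (arr vis))))
            (ℕ.≤-trans (ℕ.≤-reflexive (ℕ.+-comm m n)) (ℕ.n≤1+n _)))
          (ℕ.≤-trans room (ℕ.≤-trans n≤N (ℕ.m≤m+n N 0)))

      finish : ∀ {k σ} → Exploring k σ → eval (leq rOne rTot) σ ≡ false → Finished σ
      finish {σ = σ} x test = go x
        (ℕ.n<1⇒n≡0 (ℕ.≰⇒> (test-false (Base.constant (Exploring.bs x) 0)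
          (trans (Exploring.tot≡ x) (cong₂ _+_ (Exploring.sp≡ x) (Exploring.cp≡ x))) test)))
        where
        go : ∀ {k} (x : Exploring k σ) → length (Exploring.st x) + length (Exploring.cs x) ≡ 0 → Finished σ
        go record { st = _ ∷ _ } ()
        go record { st = [] ; cs = _ ∷ _ } ()
        go x@record { st = [] ; cs = [] } _ = record
          { Exploring x using (arr; rs; bs; verdict; chosen; rp≡; sp≡)
          ; selected = Roots-finish R cs₀ (Exploring.roots x) }

      select : AllPairs R cs₀ → Triple (λ σ → ∃[ arr ] Ready off cs₀ arr σ) pass _ Finished
      select ord = clear ⊕ link ⊕ straight (instr (add rTot rSp rCp)) (enter ord) ⊕
        loop Exploring 2 (λ started → started) (λ x test → node-step x , cand-step x test) finish

  contents-tabulate : ∀ {k} {X : Set} {d : X} (f : Fin k → X) {ys} (i : Fin k) →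
                      contents d (List.tabulate f ++ ys) (toℕ i) ≡ f i
  contents-tabulate f Fin.zero    = refl
  contents-tabulate f (Fin.suc i) = contents-tabulate (f ∘ Fin.suc) i

  contents-++ : ∀ {k} {X : Set} {d : X} (f : Fin k → X) {ys} i →
                contents d (List.tabulate f ++ ys) (k + i) ≡ contents d ys i
  contents-++ {zero}  f i = refl
  contents-++ {suc k} f i = contents-++ (f ∘ Fin.suc) i

  contents-tabulate′ : ∀ {k} {X : Set} {d : X} (f : Fin k → X) (i : Fin k) →
                       contents d (List.tabulate f) (toℕ i) ≡ f i
  contents-tabulate′ f Fin.zero    = refl
  contents-tabulate′ f (Fin.suc i) = contents-tabulate′ (f ∘ Fin.suc) i

  initialise : Triple (_≡ input I) setup _ (Checking 0 ∘ exec (const rI 1))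
  initialise = straight setup λ { refl → record
    -- Defining the arrays as what memory holds makes `rep` trivial; `consts` holds by computation
    -- because `setup` adds the extents in the order and bracketing of `start`.
    { arr = λ r i → mem (input I) (layout r + i)
    ; bs = record
      { consts = refl
      ; disjoint = layout-disjoint
      ; rep = represents λ _ _ → refl
      ; flags = contents-tabulate bit
      ; sources = λ e → trans (contents-++ bit (toℕ e)) (contents-tabulate (toℕ ∘ src) e)
      ; targets = λ e → trans (cong (mem (input I) ∘ (3 +_)) (ℕ.+-assoc n m (toℕ e)))
          (trans (contents-++ bit (m + toℕ e)) (trans (contents-++ (toℕ ∘ src) (toℕ e)) (contents-tabulate′ (toℕ ∘ tgt) e)))
      ; weights = contents-tabulate′ weight
      ; unit = refl
      ; ans = refl }
    ; i≡ = refl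
    ; bad⇔ = mk⇔ (λ _ _ ()) (λ _ → refl)
    ; cp≡0 = refl ; rp≡0 = refl ; sp≡0 = refl } }

  exchange-ready : ∀ {off cs R} {σ} (f : Finished off cs R σ) →
    wp exchange (λ τ → ∃[ arr ] Ready (off ∘ swap) (Finished.rs f) arr τ) σ
  exchange-ready {off} {cs} {R} {σ} f = arr ∘ swap , record
    { bs = record
      { Base bs using (flags; sources; targets; weights; unit; ans)
      ; consts =
          cong₂ _∷_ (constant 0) (cong₂ _∷_ (constant 1) (cong₂ _∷_ (constant 2) (cong₂ _∷_ (constant 3)
          (cong₂ _∷_ (constant 4) (cong₂ _∷_ (constant 5) (cong₂ _∷_ (constant 6) (cong₂ _∷_ (constant 7)
          (cong₂ _∷_ (constant 8) (cong₂ _∷_ (constant 9) (cong₂ _∷_ (constant 10)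
          (cong₂ _∷_ (plus-zero (constant 12)) (cong₂ _∷_ (plus-zero (plus-zero (constant 11))) (cong₂ _∷_ (constant 13) refl)))))))))))))
      ; disjoint = swap-disjoint disjoint
      ; rep = represents λ r i< → at rep (swap r) (subst (_ <_) (sym (extent-swap r)) i<) }
    ; verdict = verdict
    ; cands = chosen
    ; room = Selected.room selected
    ; cp≡ = plus-zero rp≡
    ; rp≡ = refl
    ; sp≡ = sp≡ }
    where
    open Finished f
    open Base bs
    plus-zero : ∀ {a b} → a ≡ b → a + reg σ rZero ≡ b
    plus-zero a≡b = trans (cong₂ _+_ a≡b (constant 1)) (ℕ.+-identityʳ _)

  module _ (c≡0 : c ≡ 0ℚ) {cs₁ rs₁ : List (Fin n)} (cs₁≡A : Collected cs₁)
           (sel₁ : Selected (λ _ _ → ⊤) cs₁ rs₁) where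
    open Collected cs₁≡A

    decide : ∀ {σ} → Finished (layout ∘ swap) rs₁ Unreached σ → wp answer (λ τ → Accepting τ ⇔ Effectors I) σ
    decide {σ} f = closed , leaky
      where
      open Finished f
      open Base bs
      effective : ∀ {X} → C G A X ℚ.≤ c → ZeroCost G A X
      effective {X} C≤c = C≤0⇒ZeroCost G (subst (C G A X ℚ.≤_) c≡0 C≤c)
      closed : (reg σ rBad ℕ.≤ᵇ reg σ rZero) ≡ true → _
      closed test = few , many
        where
        few : (reg σ rRp ℕ.≤ᵇ reg σ rB) ≡ true → _
        few test′ = mk⇔
          (λ _ → fromList rs ,
            ℕ.≤-trans (∣fromList∣≤length rs) (test-true rp≡ (constant 4) test′) ,
            subst (C G A (fromList rs) ℚ.≤_) (sym c≡0) (ℚ.≤-reflexive (ZeroCost⇒C≡0 G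
              (ZeroCost-selected sound complete sel₁ selected
                (Equivalence.to verdict (ℕ.n≤0⇒n≡0 (test-true refl (constant 1) test)))))))
          (λ _ → refl)
        many : (reg σ rRp ℕ.≤ᵇ reg σ rB) ≡ false → _
        many test′ = mk⇔
          (λ acc → contradiction (trans (sym ans) acc) λ ())
          (λ { (X , ∣X∣≤b , C≤c) → contradiction
            (ℕ.≤-trans (length≤∣ZeroCost∣ sound complete sel₁ selected (effective C≤c)) ∣X∣≤b)
            (test-false rp≡ (constant 4) test′) })
      leaky : (reg σ rBad ℕ.≤ᵇ reg σ rZero) ≡ false → _
      leaky test = mk⇔
        (λ acc → contradiction (trans (sym ans) acc) λ ())
        (λ { (X , _ , C≤c) → contradiction
          (ℕ.≤-reflexive (Equivalence.from verdict (ZeroCost.closed (effective C≤c))))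
          (test-false refl (constant 1) test) })

  -- The lists of candidates and of selected nodes are ghost data. Fixing them between two program
  -- parts lets all later assertions refer to them.
  ∃-elim : ∀ {X : Set} {Pre : X → State → Set} {P k Post} → (∀ a → Triple (Pre a) P k Post) →
           Triple (λ σ → ∃[ a ] Pre a σ) P k Post
  ∃-elim t = triple λ { (a , pre) → run (t a) pre }

  ×-elim : ∀ {X : Set} {Pre : State → Set} {P k Post} → (X → Triple Pre P k Post) →
           Triple (λ σ → X × Pre σ) P k Post
  ×-elim t = triple λ { (a , pre) → run (t a) pre }

  Solved : State → Set
  Solved τ = Accepting τ ⇔ Effectors I

  AllPairs-⊤ : (vs : List (Fin n)) → AllPairs (λ _ _ → ⊤) vs
  AllPairs-⊤ []       = []
  AllPairs-⊤ (v ∷ vs) = All.universal (λ _ → tt) vs ∷ AllPairs-⊤ vs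

  correct : c ≡ 0ℚ → Triple (_≡ input I) program _ Solved
  correct c≡0 =
    initialise ⊕ check ⊕ collect ⊕ ∃-elim λ cs₁ → ×-elim λ collected →
    select layout cs₁ (λ _ _ → ⊤) (AllPairs-⊤ cs₁) ⊕
    straight exchange (λ f → Finished.rs f , Finished.selected f , exchange-ready f) ⊕
    ∃-elim λ rs₁ → ×-elim λ sel₁ →
    select (layout ∘ swap) rs₁ Unreached (Selected.fresh sel₁) ⊕
    straight answer (decide c≡0 collected sel₁)

-- 256 is the sum of the costs in Verification.correct.
lemma1 : SolvableInLinearTime (λ I → Instance.c I ≡ 0ℚ) Effectors
lemma1 = program , 256 , λ I c≡0 → Hoare.run (Verification.correct I c≡0) refl
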